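{- If a PDL formula $\varphi$ is valid, then for any label $x$ the sequent $\Rightarrow x:\varphi$ (empty antecedent) is derivable in $\mathbf{G3PDL}^{\omega}$.
   Context: PDL syntax: with countably many atomic propositions $p$ and atomic programs $a$, formulas and programs are given mutually by $\varphi,\psi ::= \bot \mid p \mid \varphi\wedge\psi \mid \varphi\vee\psi \mid \varphi\rightarrow\psi \mid [\alpha]\varphi$ and $\alpha,\beta ::= a \mid \alpha;\beta \mid \alpha\cup\beta \mid \varphi? \mid \alpha^{*}$, with the standard Kripke semantics: a model $\mathfrak m=(S,I)$ gives $I(p)\subseteq S$, $I(a)\subseteq S\times S$; $;$ is relational composition, $\cup$ union, $[\![\varphi?]\!]$ the identity on $[\![\varphi]\!]$, $[\![\alpha^*]\!]$ the reflexive–transitive closure of $[\![\alpha]\!]$, and $s\in[\![[\alpha]\varphi]\!]$ iff every $\alpha$-successor of $s$ is in $[\![\varphi]\!]$. A formula is valid if it holds at every state of every model. Labelled sequents: relational atoms $x\xrightarrow{a}y$ and labelled formulas $x:\varphi$ over a countable set of labels; a sequent $\Gamma\Rightarrow\Delta$ has finite sets $\Gamma,\Delta$ of these. Rules of $\mathbf{G3PDL}^{\infty}$ (premises / conclusion; "$A,\Gamma$" means $\{A\}\cup\Gamma$): (Ax) $A\Rightarrow A$; ($\bot$) $x:\bot\Rightarrow$; (WL) $\Gamma\Rightarrow\Delta$ / $A,\Gamma\Rightarrow\Delta$; (WR) $\Gamma\Rightarrow\Delta$ / $\Gamma\Rightarrow\Delta,A$; ($\wedge$L) $x:\varphi,x:\psi,\Gamma\Rightarrow\Delta$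 / $x:\varphi\wedge\psi,\Gamma\Rightarrow\Delta$; ($\wedge$R) $\Gamma\Rightarrow\Delta,x:\varphi$ and $\Gamma\Rightarrow\Delta,x:\psi$ / $\Gamma\Rightarrow\Delta,x:\varphi\wedge\psi$; ($\vee$L) $x:\varphi,\Gamma\Rightarrow\Delta$ and $x:\psi,\Gamma\Rightarrow\Delta$ / $x:\varphi\vee\psi,\Gamma\Rightarrow\Delta$; ($\vee$R) $\Gamma\Rightarrow\Delta,x:\varphi,x:\psi$ / $\Gamma\Rightarrow\Delta,x:\varphi\vee\psi$; ($\rightarrow$L) $\Gamma\Rightarrow\Delta,x:\varphi$ and $x:\psi,\Gamma\Rightarrow\Delta$ / $x:\varphi\rightarrow\psi,\Gamma\Rightarrow\Delta$; ($\rightarrow$R) $x:\varphi,\Gamma\Rightarrow\Delta,x:\psi$ / $\Gamma\Rightarrow\Delta,x:\varphi\rightarrow\psi$; ($\Box$L) $y:\varphi,\Gamma\Rightarrow\Delta$ / $x:[a]\varphi,x\xrightarrow{a}y,\Gamma\Rightarrow\Delta$; ($\Box$R) $x\xrightarrow{a}y,\Gamma\Rightarrow\Delta,y:\varphi$ / $\Gamma\Rightarrow\Delta,x:[a]\varphi$ with $y$ fresh; (;L/R) replace $x:[\alpha;\beta]\varphi$ by $x:[\alpha][\beta]\varphi$ on the same side; ($\cup$L) $x:[\alpha]\varphi,x:[\beta]\varphi,\Gamma\Rightarrow\Delta$ / $x:[\alpha\cup\beta]\varphi,\Gamma\Rightarrow\Delta$; ($\cup$R) $\Gamma\Rightarrow\Delta,x:[\alpha]\varphi$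 and $\Gamma\Rightarrow\Delta,x:[\beta]\varphi$ / $\Gamma\Rightarrow\Delta,x:[\alpha\cup\beta]\varphi$; (?L) $\Gamma\Rightarrow\Delta,x:\varphi$ and $x:\psi,\Gamma\Rightarrow\Delta$ / $x:[\varphi?]\psi,\Gamma\Rightarrow\Delta$; (?R) $x:\varphi,\Gamma\Rightarrow\Delta,x:\psi$ / $\Gamma\Rightarrow\Delta,x:[\varphi?]\psi$; ($*$L) $x:\varphi,x:[\alpha][\alpha^*]\varphi,\Gamma\Rightarrow\Delta$ / $x:[\alpha^*]\varphi,\Gamma\Rightarrow\Delta$; ($*$R) $\Gamma\Rightarrow\Delta,x:\varphi$ and $\Gamma\Rightarrow\Delta,x:[\alpha][\alpha^*]\varphi$ / $\Gamma\Rightarrow\Delta,x:[\alpha^*]\varphi$; (Subst) $\Gamma\Rightarrow\Delta$ / $\Gamma[x/y]\Rightarrow\Delta[x/y]$ (replace $x$ by $y$); (Cut) $\Gamma\Rightarrow\Delta,A$ and $A,\Sigma\Rightarrow\Pi$ / $\Gamma,\Sigma\Rightarrow\Delta,\Pi$. Trace values $\tau=(x,\alpha_1\cdots\alpha_n,\beta,\varphi)$ stand for $x:[\alpha_1]\cdots[\alpha_n][\beta^*]\varphi$ (spine $\alpha_1\cdots\alpha_n$); $[\gamma]\tau$ prepends $\gamma$ to the spine, $y:\tau$ changes the label. $(\tau,\tau')$ is a trace pair for conclusion $\Gamma\Rightarrow\Delta$ and premise $\Gamma'\Rightarrow\Delta'$ if $\tau\in\Delta,\tau'\in\Delta'$ and: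 if $\tau$ is principal then $\tau'$ is its immediate ancestor with, for ($\Box$R) $\tau=x:[a]\tau'$, for (?R) $\tau=[\varphi?]\tau'$, for (;R) $\tau=[\alpha;\beta]\tau''$, $\tau'=[\alpha][\beta]\tau''$, for ($\cup$R) $\tau=[\alpha\cup\beta]\tau''$ and $\tau'=[\alpha]\tau''$ resp. $[\beta]\tau''$ in left resp. right premise, for ($*$R) $\tau=[\alpha^*]\tau'$ (left premise) or $\tau'=[\alpha]\tau$ (right premise); if $\tau$ is not principal then $\tau'=\tau$, except under (Subst) where $\tau$ is $\tau'$ with the substitution applied to its label. It is progressing if $\tau$ is principal with empty spine. A trace follows an infinite path of sequents if from some point on its consecutive values form trace pairs along the path. A $\mathbf{G3PDL}^{\infty}$ proof is a possibly infinite derivation tree in which every infinite path is followed by a trace with infinitely many progressing pairs. A $\mathbf{G3PDL}^{\omega}$ proof is a finite derivation tree whose non-axiom leaves (buds) are each assigned an internal node (companion) with a syntactically identical sequent, such that its infinite unfolding is a $\mathbf{G3PDL}^{\infty}$ proof; a sequent is derivable in $\mathbf{G3PDL}^{\omega}$ if it has such a proof (instances of (Cut) are allowed). -}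

module Defs where

open import Level using (0ℓ)
open import Data.Nat using (ℕ; zero; suc; _≤_; _<_; _≡ᵇ_)
open import Data.Bool using (if_then_else_)
open import Data.List using (List; []; _∷_; _++_; [_]; map; length)
open import Data.List.Membership.Propositional using (_∈_)
open import Data.List.Relation.Unary.Any using (Any)
open import Data.List.Relation.Binary.Subset.Propositional using (_⊆_)
open import Data.Maybe using (Maybe; just; nothing)
open import Data.Product using (Σ; _×_; _,_; ∃)
open import Data.Sum using (_⊎_)
open import Data.Empty using (⊥)
open import Data.Unit using (⊤)
open import Relation.Nullary using (¬_)
open import Relation.Binary.PropositionalEquality using (_≡_)
open import Relation.Binary.Construct.Closure.ReflexiveTransitive using (Star)
open import Axiom.ExcludedMiddle using (ExcludedMiddle)

infixr 6 _∧'_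
infixr 5 _∨'_
infixr 4 _⇒'_

mutual
  data Fm : Set where
    ⊥'   : Fm
    var  : ℕ → Fm
    _∧'_ : Fm → Fm → Fm
    _∨'_ : Fm → Fm → Fm
    _⇒'_ : Fm → Fm → Fm
    □[_]_ : Pg → Fm → Fm

  data Pg : Set where
    atom  : ℕ → Pg
    _⨟_   : Pg → Pg → Pg
    _∪'_  : Pg → Pg → Pg
    _¿    : Fm → Pg
    _⋆    : Pg → Pg

record Model : Set₁ where
  field
    S : Set
    V : ℕ → S → Set
    R : ℕ → S → S → Set

module _ (𝔪 : Model) where
  open Model 𝔪
  mutual
    ⟦_⟧F : Fm → S → Set
    ⟦ ⊥' ⟧F s = ⊥
    ⟦ var p ⟧F s = V p s
    ⟦ φ ∧' ψ ⟧F s = ⟦ φ ⟧F s × ⟦ ψ ⟧F s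
    ⟦ φ ∨' ψ ⟧F s = ⟦ φ ⟧F s ⊎ ⟦ ψ ⟧F s
    ⟦ φ ⇒' ψ ⟧F s = ⟦ φ ⟧F s → ⟦ ψ ⟧F s
    ⟦ □[ α ] φ ⟧F s = ∀ t → ⟦ α ⟧P s t → ⟦ φ ⟧F t

    ⟦_⟧P : Pg → S → S → Set
    ⟦ atom a ⟧P s t = R a s t
    ⟦ α ⨟ β ⟧P s t = Σ S λ u → ⟦ α ⟧P s u × ⟦ β ⟧P u t
    ⟦ α ∪' β ⟧P s t = ⟦ α ⟧P s t ⊎ ⟦ β ⟧P s t
    ⟦ φ ¿ ⟧P s t = s ≡ t × ⟦ φ ⟧F s
    ⟦ α ⋆ ⟧P s t = Star ⟦ α ⟧P s t

Valid : Fm → Set₁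
Valid φ = (𝔪 : Model) (s : Model.S 𝔪) → ⟦ 𝔪 ⟧F φ s

-- Labelled sequents (finite sets represented by lists, compared as sets)

Label : Set
Label = ℕ

data Item : Set where
  _⟶[_]_ : Label → ℕ → Label → Item
  _∶_     : Label → Fm → Item

record Seq : Set where
  constructor _⇒_
  field
    ant : List Item
    succ : List Item
open Seq public

_≈S_ : Seq → Seq → Set
(Γ ⇒ Δ) ≈S (Γ' ⇒ Δ') = (Γ ⊆ Γ' × Γ' ⊆ Γ) × (Δ ⊆ Δ' × Δ' ⊆ Δ)

Occurs : Label → Item → Set
Occurs y (x ⟶[ a ] z) = y ≡ x ⊎ y ≡ z
Occurs y (x ∶ φ) = y ≡ x

Fresh : Label → Seq → Set
Fresh y (Γ ⇒ Δ) = ¬ Any (Occurs y) (Γ ++ Δ)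

subL : Label → Label → Label → Label
subL x y z = if z ≡ᵇ x then y else z

subI : Label → Label → Item → Item
subI x y (u ⟶[ a ] v) = subL x y u ⟶[ a ] subL x y v
subI x y (u ∶ φ) = subL x y u ∶ φ

-- Rules of G3PDL^∞ : Rule premises conclusion
-- (the principal formula of a right rule is the head of the succedent)

data Rule : List Seq → Seq → Set where
  ax    : (A : Item) → Rule [] ([ A ] ⇒ [ A ])
  botL  : (x : Label) → Rule [] ([ x ∶ ⊥' ] ⇒ [])
  wL    : (A : Item) (Γ Δ : List Item) → Rule [ Γ ⇒ Δ ] ((A ∷ Γ) ⇒ Δ)
  wR    : (A : Item) (Γ Δ : List Item) → Rule [ Γ ⇒ Δ ] (Γ ⇒ (A ∷ Δ))
  andL  : (x : Label) (φ ψ : Fm) (Γ Δ : List Item) →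
          Rule [ ((x ∶ φ) ∷ (x ∶ ψ) ∷ Γ) ⇒ Δ ] (((x ∶ (φ ∧' ψ)) ∷ Γ) ⇒ Δ)
  andR  : (x : Label) (φ ψ : Fm) (Γ Δ : List Item) →
          Rule ((Γ ⇒ ((x ∶ φ) ∷ Δ)) ∷ (Γ ⇒ ((x ∶ ψ) ∷ Δ)) ∷ [])
               (Γ ⇒ ((x ∶ (φ ∧' ψ)) ∷ Δ))
  orL   : (x : Label) (φ ψ : Fm) (Γ Δ : List Item) →
          Rule ((((x ∶ φ) ∷ Γ) ⇒ Δ) ∷ (((x ∶ ψ) ∷ Γ) ⇒ Δ) ∷ [])
               (((x ∶ (φ ∨' ψ)) ∷ Γ) ⇒ Δ)
  orR   : (x : Label) (φ ψ : Fm) (Γ Δ : List Item) →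
          Rule [ Γ ⇒ ((x ∶ φ) ∷ (x ∶ ψ) ∷ Δ) ] (Γ ⇒ ((x ∶ (φ ∨' ψ)) ∷ Δ))
  impL  : (x : Label) (φ ψ : Fm) (Γ Δ : List Item) →
          Rule ((Γ ⇒ ((x ∶ φ) ∷ Δ)) ∷ (((x ∶ ψ) ∷ Γ) ⇒ Δ) ∷ [])
               (((x ∶ (φ ⇒' ψ)) ∷ Γ) ⇒ Δ)
  impR  : (x : Label) (φ ψ : Fm) (Γ Δ : List Item) →
          Rule [ ((x ∶ φ) ∷ Γ) ⇒ ((x ∶ ψ) ∷ Δ) ] (Γ ⇒ ((x ∶ (φ ⇒' ψ)) ∷ Δ))
  boxL  : (x : Label) (a : ℕ) (y : Label) (φ : Fm) (Γ Δ : List Item) →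
          Rule [ ((y ∶ φ) ∷ Γ) ⇒ Δ ]
               (((x ∶ (□[ atom a ] φ)) ∷ (x ⟶[ a ] y) ∷ Γ) ⇒ Δ)
  boxR  : (x : Label) (a : ℕ) (y : Label) (φ : Fm) (Γ Δ : List Item) →
          Fresh y (Γ ⇒ ((x ∶ (□[ atom a ] φ)) ∷ Δ)) →
          Rule [ ((x ⟶[ a ] y) ∷ Γ) ⇒ ((y ∶ φ) ∷ Δ) ]
               (Γ ⇒ ((x ∶ (□[ atom a ] φ)) ∷ Δ))
  seqL  : (x : Label) (α β : Pg) (φ : Fm) (Γ Δ : List Item) →
          Rule [ ((x ∶ (□[ α ] □[ β ] φ)) ∷ Γ) ⇒ Δ ] (((x ∶ (□[ α ⨟ β ] φ)) ∷ Γ) ⇒ Δ)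
  seqR  : (x : Label) (α β : Pg) (φ : Fm) (Γ Δ : List Item) →
          Rule [ Γ ⇒ ((x ∶ (□[ α ] □[ β ] φ)) ∷ Δ) ] (Γ ⇒ ((x ∶ (□[ α ⨟ β ] φ)) ∷ Δ))
  unionL : (x : Label) (α β : Pg) (φ : Fm) (Γ Δ : List Item) →
          Rule [ ((x ∶ (□[ α ] φ)) ∷ (x ∶ (□[ β ] φ)) ∷ Γ) ⇒ Δ ]
               (((x ∶ (□[ α ∪' β ] φ)) ∷ Γ) ⇒ Δ)
  unionR : (x : Label) (α β : Pg) (φ : Fm) (Γ Δ : List Item) →
          Rule ((Γ ⇒ ((x ∶ (□[ α ] φ)) ∷ Δ)) ∷ (Γ ⇒ ((x ∶ (□[ β ] φ)) ∷ Δ)) ∷ [])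
               (Γ ⇒ ((x ∶ (□[ α ∪' β ] φ)) ∷ Δ))
  testL : (x : Label) (φ ψ : Fm) (Γ Δ : List Item) →
          Rule ((Γ ⇒ ((x ∶ φ) ∷ Δ)) ∷ (((x ∶ ψ) ∷ Γ) ⇒ Δ) ∷ [])
               (((x ∶ (□[ φ ¿ ] ψ)) ∷ Γ) ⇒ Δ)
  testR : (x : Label) (φ ψ : Fm) (Γ Δ : List Item) →
          Rule [ ((x ∶ φ) ∷ Γ) ⇒ ((x ∶ ψ) ∷ Δ) ] (Γ ⇒ ((x ∶ (□[ φ ¿ ] ψ)) ∷ Δ))
  starL : (x : Label) (α : Pg) (φ : Fm) (Γ Δ : List Item) →
          Rule [ ((x ∶ φ) ∷ (x ∶ (□[ α ] □[ α ⋆ ] φ)) ∷ Γ) ⇒ Δ ]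
               (((x ∶ (□[ α ⋆ ] φ)) ∷ Γ) ⇒ Δ)
  starR : (x : Label) (α : Pg) (φ : Fm) (Γ Δ : List Item) →
          Rule ((Γ ⇒ ((x ∶ φ) ∷ Δ)) ∷ (Γ ⇒ ((x ∶ (□[ α ] □[ α ⋆ ] φ)) ∷ Δ)) ∷ [])
               (Γ ⇒ ((x ∶ (□[ α ⋆ ] φ)) ∷ Δ))
  subst : (x y : Label) (Γ Δ : List Item) →
          Rule [ Γ ⇒ Δ ] (map (subI x y) Γ ⇒ map (subI x y) Δ)
  cut   : (A : Item) (Γ Δ Σ' Π : List Item) →
          Rule ((Γ ⇒ (A ∷ Δ)) ∷ ((A ∷ Σ') ⇒ Π) ∷ []) ((Γ ++ Σ') ⇒ (Δ ++ Π))

principalR : ∀ {ps c} → Rule ps c → Maybe Item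
principalR (wR A Γ Δ) = just A
principalR (andR x φ ψ Γ Δ) = just (x ∶ (φ ∧' ψ))
principalR (orR x φ ψ Γ Δ) = just (x ∶ (φ ∨' ψ))
principalR (impR x φ ψ Γ Δ) = just (x ∶ (φ ⇒' ψ))
principalR (boxR x a y φ Γ Δ _) = just (x ∶ (□[ atom a ] φ))
principalR (seqR x α β φ Γ Δ) = just (x ∶ (□[ α ⨟ β ] φ))
principalR (unionR x α β φ Γ Δ) = just (x ∶ (□[ α ∪' β ] φ))
principalR (testR x φ ψ Γ Δ) = just (x ∶ (□[ φ ¿ ] ψ))
principalR (starR x α φ Γ Δ) = just (x ∶ (□[ α ⋆ ] φ))
principalR _ = nothing

-- Trace values (x, α₁⋯αₙ, β, φ) standing for x:[α₁]⋯[αₙ][β*]φ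

record TV : Set where
  constructor tv
  field
    lbl   : Label
    spine : List Pg
    body  : Pg
    fml   : Fm
open TV public

boxes : List Pg → Fm → Fm
boxes [] φ = φ
boxes (α ∷ αs) φ = □[ α ] boxes αs φ

tvItem : TV → Item
tvItem (tv x s β φ) = x ∶ boxes s (□[ β ⋆ ] φ)

premSucc : List Seq → ℕ → List Item
premSucc [] i = []
premSucc (p ∷ ps) zero = succ p
premSucc (p ∷ ps) (suc i) = premSucc ps i

PrinPair : ∀ {ps c} → Rule ps c → ℕ → TV → TV → Set
PrinPair (boxR x a y φ Γ Δ _) zero τ τ' =
  tvItem τ' ≡ (y ∶ φ) × τ ≡ tv x (atom a ∷ spine τ') (body τ') (fml τ')
PrinPair (testR x φ ψ Γ Δ) zero τ τ' =
  τ ≡ tv (lbl τ') ((φ ¿) ∷ spine τ') (body τ') (fml τ')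
PrinPair (seqR x α β φ Γ Δ) zero τ τ' =
  Σ (List Pg) λ s → spine τ ≡ (α ⨟ β) ∷ s × τ' ≡ tv (lbl τ) (α ∷ β ∷ s) (body τ) (fml τ)
PrinPair (unionR x α β φ Γ Δ) zero τ τ' =
  Σ (List Pg) λ s → spine τ ≡ (α ∪' β) ∷ s × τ' ≡ tv (lbl τ) (α ∷ s) (body τ) (fml τ)
PrinPair (unionR x α β φ Γ Δ) (suc zero) τ τ' =
  Σ (List Pg) λ s → spine τ ≡ (α ∪' β) ∷ s × τ' ≡ tv (lbl τ) (β ∷ s) (body τ) (fml τ)
PrinPair (starR x α φ Γ Δ) zero τ τ' =
  τ ≡ tv (lbl τ') ((α ⋆) ∷ spine τ') (body τ') (fml τ')
PrinPair (starR x α φ Γ Δ) (suc zero) τ τ' =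
  τ' ≡ tv (lbl τ) (α ∷ spine τ) (body τ) (fml τ)
PrinPair _ _ τ τ' = ⊥

NonPrinPair : ∀ {ps c} → Rule ps c → TV → TV → Set
NonPrinPair (subst x y Γ Δ) τ τ' = τ ≡ tv (subL x y (lbl τ')) (spine τ') (body τ') (fml τ')
NonPrinPair _ τ τ' = τ' ≡ τ

TracePair : ∀ {ps c} → Rule ps c → ℕ → TV → TV → Set
TracePair {ps} {c} r i τ τ' =
  tvItem τ ∈ succ c × tvItem τ' ∈ premSucc ps i ×
  ((principalR r ≡ just (tvItem τ) × PrinPair r i τ τ')
   ⊎ (¬ (principalR r ≡ just (tvItem τ)) × NonPrinPair r τ τ'))

Progressing : ∀ {ps c} → Rule ps c → ℕ → TV → TV → Set
Progressing r i τ τ' =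
  TracePair r i τ τ' × principalR r ≡ just (tvItem τ) × spine τ ≡ []

data Tree : Set where
  bud  : Seq → Tree
  node : {ps : List Seq} {c : Seq} → Rule ps c → List Tree → Tree

root : Tree → Seq
root (bud s) = s
root (node {c = c} r ts) = c

mutual
  WF : Tree → Set
  WF (bud s) = ⊤
  WF (node {ps = ps} r ts) = WFs ts ps

  WFs : List Tree → List Seq → Set
  WFs [] [] = ⊤
  WFs (t ∷ ts) (p ∷ ps) = (root t ≈S p) × WF t × WFs ts ps
  WFs _ _ = ⊥

Addr : Set
Addr = List ℕ

mutual
  at : Tree → Addr → Maybe Tree
  at t [] = just t
  at (bud s) (i ∷ u) = nothing
  at (node r ts) (i ∷ u) = atL ts i u

  atL : List Tree → ℕ → Addr → Maybe Tree
  atL [] i u = nothing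
  atL (t ∷ ts) zero u = at t u
  atL (t ∷ ts) (suc i) u = atL ts i u

IsCompanionFor : Maybe Tree → Seq → Set
IsCompanionFor (just (node {c = c} r (_ ∷ _))) s = c ≈S s
IsCompanionFor _ s = ⊥

CompanionsOK : Tree → (Addr → Addr) → Set
CompanionsOK t comp = ∀ u s → at t u ≡ just (bud s) → IsCompanionFor (at t (comp u)) s

-- position in the infinite unfolding: buds are replaced by their companions
resolve′ : Maybe Tree → (Addr → Addr) → Addr → Addr
resolve′ (just (bud s)) comp u = comp u
resolve′ _ comp u = u

resolve : Tree → (Addr → Addr) → Addr → Addr
resolve t comp u = resolve′ (at t u) comp u

IsStep : Maybe Tree → ℕ → Set
IsStep (just (node r ts)) i = i < length ts
IsStep _ i = ⊥

PairAt : Maybe Tree → ℕ → TV → TV → Set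
PairAt (just (node r ts)) i τ τ' = TracePair r i τ τ'
PairAt _ i τ τ' = ⊥

ProgAt : Maybe Tree → ℕ → TV → TV → Set
ProgAt (just (node r ts)) i τ τ' = Progressing r i τ τ'
ProgAt _ i τ τ' = ⊥

record Path (t : Tree) (comp : Addr → Addr) : Set where
  field
    pos   : ℕ → Addr
    dir   : ℕ → ℕ
    start : pos 0 ≡ resolve t comp []
    step  : ∀ k → IsStep (at t (pos k)) (dir k)
    next  : ∀ k → pos (suc k) ≡ resolve t comp (pos k ++ [ dir k ])

FollowedByProgressingTrace : (t : Tree) (comp : Addr → Addr) → Path t comp → Set
FollowedByProgressingTrace t comp π =
  Σ (ℕ → TV) λ τ → Σ ℕ λ N →
    (∀ k → N ≤ k → PairAt (at t (pos k)) (dir k) (τ k) (τ (suc k))) ×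
    (∀ M → Σ ℕ λ k → M ≤ k × N ≤ k ×
             ProgAt (at t (pos k)) (dir k) (τ k) (τ (suc k)))
  where open Path π

IsProofω : Tree → (Addr → Addr) → Set
IsProofω t comp =
  WF t × CompanionsOK t comp × (∀ (π : Path t comp) → FollowedByProgressingTrace t comp π)

Derivableω : Seq → Set
Derivableω s = Σ Tree λ t → Σ (Addr → Addr) λ comp → IsProofω t comp × (root t ≈S s)

{-# OPTIONS --safe #-}
module Submission where

{-
A filtration argument in which derivability is the consistency notion. The worlds are the consistent
conjunctions of literals over the (Fischer–Ladner style) closure of φ. By induction on α, if F is
entailed by every α-successor of a world s, then s entails [α]F; for α⋆ this uses the disjunction of
the reachable worlds as an invariant and the loop
rule "from x : A ⇒ x : C and x : A ⇒ x : [α]A infer x : A ⇒ x : [α⋆]C".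

The loop rule is the only place where cycles are created. Its proof pushes [α]A ⇒ [α][α⋆]C down to
A ⇒ [α⋆]C by decomposing α on both sides, with one back edge for each star met on the way. The
right-hand formula of a sequent is boxes s C, and the rules act on s as on a stack. On an infinite
path, some star γ⋆ becomes the bottom of the part of the stack that is still changing; the trace is
read off by cutting the stack above it.
-}

open import Defs
open import Level using (0ℓ)
open import Data.List using ([]; [_])
open import Axiom.ExcludedMiddle using (ExcludedMiddle)
open import Data.Bool using (true; if_then_else_)
open import Data.Empty using (⊥; ⊥-elim)
open import Data.List using (List; _∷_; _++_; map; length; filter)
open import Data.List.Membership.Propositional using (_∈_)
open import Data.List.Membership.Propositional.Properties
  using (∈-++⁺ˡ; ∈-++⁺ʳ; ∈-++⁻; ∈-map⁺; ∈-map⁻; ∈-filter⁺; ∈-filter⁻)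
open import Data.List.Properties using (++-assoc; ++-identityʳ; ++-cancelʳ; ∷-injectiveˡ)
open import Data.List.Relation.Binary.Subset.Propositional using (_⊆_)
open import Data.List.Relation.Binary.Subset.Propositional.Properties using () renaming (map⁺ to ⊆-map⁺)
open import Data.List.Relation.Unary.All using (All; []; _∷_; lookup)
open import Data.List.Relation.Unary.Any using (here; there)
open import Data.Maybe using (just; nothing)
open import Data.Nat using (ℕ; zero; suc; _+_; _∸_; _≤_; _<_; s≤s; z≤n; _≡ᵇ_)
open import Data.Nat.Properties
  using (+-assoc; +-suc; +-identityʳ; +-monoʳ-≤; m≤m+n; m≤n+m; m+n∸m≡n; m≤n⇒∃[o]m+o≡n;
         ≤-refl; ≤-trans; ≤-pred; <-≤-trans; n≤1+n; m≤n⇒m<n∨m≡n; 1+n≢n)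
open import Data.Product using (_×_; _,_; proj₁; proj₂; Σ-syntax)
open import Data.Sum using (_⊎_; inj₁; inj₂; map₂)
open import Data.Unit using (⊤; tt)
open import Function using (id; _∘_)
open import Relation.Binary.Construct.Closure.ReflexiveTransitive using (Star; ε; _◅_; _◅◅_)
open import Relation.Binary.PropositionalEquality
  using (_≡_; refl; sym; trans; cong) renaming (subst to ≡-subst)
open import Relation.Nullary using (¬_; yes; no)

-- Equality of sequents

≈-refl : ∀ {s} → s ≈S s
≈-refl = (id , id) , (id , id)

≈-trans : ∀ {s s' s''} → s ≈S s' → s' ≈S s'' → s ≈S s''
≈-trans ((a , b) , (c , d)) ((a' , b') , (c' , d')) =
  ((λ z → a' (a z)) , (λ z → b (b' z))) , ((λ z → c' (c z)) , (λ z → d (d' z)))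

derivable-≈ : ∀ {s s'} → s ≈S s' → Derivableω s → Derivableω s'
derivable-≈ e (t , comp , pf , e') = t , comp , pf , ≈-trans e' e

-- Cyclic proofs from finite trees with annotated back edges

module Plug (em : ExcludedMiddle 0ℓ) (I : Set) (seqOf : I → Seq)
            (Edge : ∀ {ps c} → Rule ps c → ℕ → I → I → Set) where

  -- Finite trees with back edges: Ks lists the annotations of the proper ancestors, nearest first, a
  -- leaf may point back to one of them, and Edge constrains the annotations along an edge.
  mutual
    data T (Ks : List I) (i : I) : Set where
      back : i ∈ Ks → T Ks i
      rule : ∀ {ps c} (r : Rule ps c) → c ≈S seqOf i → Ts (i ∷ Ks) r i 0 ps → T Ks i

    data Ts (Ks : List I) {qs c} (r : Rule qs c) (i : I) : ℕ → List Seq → Set where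
      []   : ∀ {n} → Ts Ks r i n []
      done : ∀ {n p ps} → Derivableω p → Ts Ks r i (suc n) ps → Ts Ks r i n (p ∷ ps)
      more : ∀ {n p ps} (j : I) → seqOf j ≈S p → Edge r n i j → T Ks j →
             Ts Ks r i (suc n) ps → Ts Ks r i n (p ∷ ps)

  -- An infinite path with its addresses forgotten: only annotations and rules remain, so the trace
  -- condition can be checked without reference to trees.
  Run : Set
  Run = Σ[ ι ∈ (ℕ → I) ] ∀ k → Σ[ ps ∈ List Seq ] Σ[ c ∈ Seq ] Σ[ r ∈ Rule ps c ] Σ[ d ∈ ℕ ]
          Edge r d (ι k) (ι (suc k))

  Traced : Run → Set
  Traced (ι , ρ) = Σ[ τ ∈ (ℕ → TV) ] Σ[ N ∈ ℕ ]
    (∀ k → N ≤ k → let (_ , _ , r , d , _) = ρ k in TracePair r d (τ k) (τ (suc k))) ×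
    (∀ M → Σ[ k ∈ ℕ ] M ≤ k × N ≤ k ×
       let (_ , _ , r , d , _) = ρ k in Progressing r d (τ k) (τ (suc k)))

  mutual
    tree : ∀ {Ks i} → T Ks i → Tree
    tree {i = i} (back _) = bud (seqOf i)
    tree (rule r _ ts) = node r (trees ts)

    trees : ∀ {Ks qs c i n ps} {r : Rule qs c} → Ts Ks r i n ps → List Tree
    trees [] = []
    trees (done (t , _) ts) = t ∷ trees ts
    trees (more _ _ _ t ts) = tree t ∷ trees ts

  Env : List I → Set
  Env = All (λ _ → Addr)

  -- The subtree sits at address a; the environment holds the addresses of its ancestors.
  mutual
    companion : ∀ {Ks i} → T Ks i → Addr → Env Ks → Addr → Addr
    companion (back m) a env u = lookup env m
    companion (rule r _ ts) a env [] = []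
    companion (rule r _ ts) a env (d ∷ u) = companions ts d (a ++ [ d ]) (a ∷ env) u

    companions : ∀ {Ks qs c i n ps} {r : Rule qs c} → Ts Ks r i n ps →
                 ℕ → Addr → Env Ks → Addr → Addr
    companions [] d a env u = []
    -- The companions of a finished derivation are relative to its own root, which sits at `a`.
    companions (done (_ , comp , _) ts) zero a env u = a ++ comp u
    companions (more _ _ _ t ts) zero a env u = companion t a env u
    companions (done _ ts) (suc d) a env u = companions ts d a env u
    companions (more _ _ _ _ ts) (suc d) a env u = companions ts d a env u

  root-tree : ∀ {Ks i} (t : T Ks i) → root (tree t) ≈S seqOf i
  root-tree (back _) = ≈-refl
  root-tree (rule _ e _) = e

  mutual
    wf-tree : ∀ {Ks i} (t : T Ks i) → WF (tree t)
    wf-tree (back _) = tt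
    wf-tree (rule r _ ts) = wf-trees ts

    wf-trees : ∀ {Ks qs c i n ps} {r : Rule qs c} (ts : Ts Ks r i n ps) → WFs (trees ts) ps
    wf-trees [] = tt
    wf-trees (done (t , comp , (wf , _) , e) ts) = e , wf , wf-trees ts
    wf-trees (more j e _ t ts) = ≈-trans (root-tree t) e , wf-tree t , wf-trees ts

  data Child {Ks qs c i n ps} {r : Rule qs c} (ts : Ts Ks r i n ps) (d : ℕ) : Set where
    done-child : ∀ {p} (D : Derivableω p) →
      (∀ v → atL (trees ts) d v ≡ at (proj₁ D) v) →
      (∀ a env v → companions ts d a env v ≡ a ++ proj₁ (proj₂ D) v) → Child ts d
    more-child : ∀ {j} → Edge r (d + n) i j → (t : T Ks j) →
      (∀ v → atL (trees ts) d v ≡ at (tree t) v) →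
      (∀ a env v → companions ts d a env v ≡ companion t a env v) → Child ts d

  edge-suc : ∀ {qs c n i j} {r : Rule qs c} d → Edge r (d + suc n) i j → Edge r (suc d + n) i j
  edge-suc {n = n} {i} {j} {r} d = ≡-subst (λ k → Edge r k i j) (+-suc d n)

  child : ∀ {Ks qs c i n ps} {r : Rule qs c} (ts : Ts Ks r i n ps) d →
          d < length (trees ts) → Child ts d
  child (done D ts) zero _ = done-child D (λ _ → refl) (λ _ _ _ → refl)
  child (more j _ e t ts) zero _ = more-child e t (λ _ → refl) (λ _ _ _ → refl)
  child (done D ts) (suc d) (s≤s d<) with child ts d d<
  ... | done-child D' p q = done-child D' p q
  ... | more-child e t p q = more-child (edge-suc d e) t p q
  child (more _ _ _ _ ts) (suc d) (s≤s d<) with child ts d d<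
  ... | done-child D' p q = done-child D' p q
  ... | more-child e t p q = more-child (edge-suc d e) t p q

  module _ {i₀} (t₀ : T [] i₀) where
    comp₀ : Addr → Addr
    comp₀ = companion t₀ [] []

    record Located {Ks i} (a : Addr) (t : T Ks i) (env : Env Ks) : Set where
      constructor located
      field
        at-eq   : ∀ v → at (tree t₀) (a ++ v) ≡ at (tree t) v
        comp-eq : ∀ v → comp₀ (a ++ v) ≡ companion t a env v
    open Located

    at-root : ∀ {Ks i a env} {t : T Ks i} → Located a t env → at (tree t₀) a ≡ just (tree t)
    at-root {a = a} l = trans (cong (at (tree t₀)) (sym (++-identityʳ a))) (at-eq l [])

    comp-root : ∀ {Ks i a env} {t : T Ks i} → Located a t env → comp₀ a ≡ companion t a env []
    comp-root {a = a} l = trans (cong comp₀ (sym (++-identityʳ a))) (comp-eq l [])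

    -- The premise list has the form `p ∷ ps` because a companion has to be an internal node, so
    -- every recorded ancestor must have a child.
    data LocatedEnv : ∀ {Ks} → Env Ks → Set where
      []  : LocatedEnv []
      ext : ∀ {Ks i p ps c a} {env : Env Ks} {r : Rule (p ∷ ps) c} {e : c ≈S seqOf i}
              {ts : Ts (i ∷ Ks) r i 0 (p ∷ ps)} →
            Located a (rule r e ts) env → LocatedEnv env → LocatedEnv {i ∷ Ks} (a ∷ env)

    record NodeAt (i : I) (a : Addr) : Set where
      constructor nodeAt
      field
        {Ks}  : List I
        {env} : Env Ks
        {ps}  : List Seq
        {c}   : Seq
        {r}   : Rule ps c
        {e}   : c ≈S seqOf i
        ts    : Ts (i ∷ Ks) r i 0 ps
        loc   : Located a (rule r e ts) env
        locs  : LocatedEnv env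

    ancestor : ∀ {Ks i} {env : Env Ks} → LocatedEnv env → (m : i ∈ Ks) → NodeAt i (lookup env m)
    ancestor (ext {ts = ts} l ls) (here refl) = nodeAt ts l ls
    ancestor (ext l ls) (there m) = ancestor ls m

    companion-ok : ∀ {Ks i s} {env : Env Ks} → LocatedEnv env → (m : i ∈ Ks) → seqOf i ≈S s →
                   IsCompanionFor (at (tree t₀) (lookup env m)) s
    companion-ok (ext {a = a} {e = e} {ts = ts} l ls) (here refl) e'
      rewrite at-root l with ts
    ... | done _ _ = ≈-trans e e'
    ... | more _ _ _ _ _ = ≈-trans e e'
    companion-ok (ext l ls) (there m) e' = companion-ok ls m e'

    child-env : ∀ {Ks i a ps c} {env : Env Ks} {r : Rule ps c} {e : c ≈S seqOf i}
      {ts : Ts (i ∷ Ks) r i 0 ps} d → d < length (trees ts) →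
      Located a (rule r e ts) env → LocatedEnv env → LocatedEnv {i ∷ Ks} (a ∷ env)
    child-env {ts = done _ _} d _ l ls = ext l ls
    child-env {ts = more _ _ _ _ _} d _ l ls = ext l ls

    assoc₁ : ∀ (a : Addr) d v → (a ++ [ d ]) ++ v ≡ a ++ d ∷ v
    assoc₁ a d v = ++-assoc a [ d ] v

    child-at : ∀ {Ks i a ps c} {env : Env Ks} {r : Rule ps c} {e : c ≈S seqOf i}
      {ts : Ts (i ∷ Ks) r i 0 ps} → Located a (rule r e ts) env → ∀ d v →
      at (tree t₀) ((a ++ [ d ]) ++ v) ≡ atL (trees ts) d v
    child-at {a = a} l d v = trans (cong (at (tree t₀)) (assoc₁ a d v)) (at-eq l (d ∷ v))

    child-comp : ∀ {Ks i a ps c} {env : Env Ks} {r : Rule ps c} {e : c ≈S seqOf i}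
      {ts : Ts (i ∷ Ks) r i 0 ps} → Located a (rule r e ts) env → ∀ d v →
      comp₀ ((a ++ [ d ]) ++ v) ≡ companions ts d (a ++ [ d ]) (a ∷ env) v
    child-comp {a = a} l d v = trans (cong comp₀ (assoc₁ a d v)) (comp-eq l (d ∷ v))

    mutual
      companions-ok : ∀ {Ks i a} {env : Env Ks} (t : T Ks i) → Located a t env → LocatedEnv env →
        ∀ v s → at (tree t) v ≡ just (bud s) → IsCompanionFor (at (tree t₀) (companion t a env v)) s
      companions-ok (back m) l ls [] s refl = companion-ok ls m ≈-refl
      companions-ok {a = a} (rule r e ts) l ls (d ∷ v) s eq =
        companions-ok-s ts d v s eq (child-at l d) (child-comp l d)
          (child-env {e = e} {ts = ts} d (nonempty ts d eq) l ls)
        where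
        nonempty : ∀ {Ks qs c i n ps} {r : Rule qs c} (ts : Ts Ks r i n ps) d {v s} →
                   atL (trees ts) d v ≡ just (bud s) → d < length (trees ts)
        nonempty (done D ts) zero _ = s≤s z≤n
        nonempty (more _ _ _ _ ts) zero _ = s≤s z≤n
        nonempty (done D ts) (suc d) eq = s≤s (nonempty ts d eq)
        nonempty (more _ _ _ _ ts) (suc d) eq = s≤s (nonempty ts d eq)

      companions-ok-s : ∀ {Ks qs c i n ps a} {r : Rule qs c} {env : Env Ks} (ts : Ts Ks r i n ps) d v s →
        atL (trees ts) d v ≡ just (bud s) →
        (∀ v → at (tree t₀) (a ++ v) ≡ atL (trees ts) d v) →
        (∀ v → comp₀ (a ++ v) ≡ companions ts d a env v) →
        LocatedEnv env →
        IsCompanionFor (at (tree t₀) (companions ts d a env v)) s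
      companions-ok-s (done (t , comp , (_ , ok , _) , _) ts) zero v s eq ae ce ls =
        ≡-subst (λ z → IsCompanionFor z s) (sym (ae (comp v))) (ok v s eq)
      companions-ok-s (more _ _ _ t ts) zero v s eq ae ce ls = companions-ok t (located ae ce) ls v s eq
      companions-ok-s (done _ ts) (suc d) v s eq ae ce ls = companions-ok-s ts d v s eq ae ce ls
      companions-ok-s (more _ _ _ _ ts) (suc d) v s eq ae ce ls = companions-ok-s ts d v s eq ae ce ls

    resolve-shift : ∀ (b : Addr) (t : Tree) comp →
      (∀ v → at (tree t₀) (b ++ v) ≡ at t v) →
      (∀ v → comp₀ (b ++ v) ≡ b ++ comp v) →
      ∀ v → resolve (tree t₀) comp₀ (b ++ v) ≡ b ++ resolve t comp v
    resolve-shift b t comp ae ce v rewrite ae v with at t v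
    ... | just (bud _) = ce v
    ... | just (node _ _) = refl
    ... | nothing = refl

    -- A path that enters a finished derivation never leaves it, because the companions lie inside
    -- it. Its tail from `n` on is a path of that derivation, and the trace found there is shifted
    -- by `n`; the values before `n` are junk.
    followed-by-suffix : ∀ {p} (D : Derivableω p) (b : Addr) →
      (∀ v → at (tree t₀) (b ++ v) ≡ at (proj₁ D) v) →
      (∀ v → comp₀ (b ++ v) ≡ b ++ proj₁ (proj₂ D) v) →
      (π : Path (tree t₀) comp₀) (n : ℕ) →
      Path.pos π n ≡ resolve (tree t₀) comp₀ b →
      FollowedByProgressingTrace (tree t₀) comp₀ π
    followed-by-suffix (t , comp , (_ , _ , follow) , _) b ae ce π n start' =
      let (τ , N , pairs , progs) = follow π' in
      (λ k → τ (k ∸ n)) , n + N ,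
      (λ k n+N≤k → pairs' τ N pairs k n+N≤k) ,
      λ M → let (k , M≤k , N≤k , pr) = progs M in
        n + k , ≤-trans M≤k (m≤n+m k n) , +-monoʳ-≤ n N≤k ,
        prog' τ k pr
      where
      open Path π

      pos' : ℕ → Addr
      pos' zero = resolve t comp []
      pos' (suc k) = resolve t comp (pos' k ++ [ dir (n + k) ])

      shift : ∀ k → pos (n + k) ≡ b ++ pos' k
      shift zero rewrite +-identityʳ n = trans start'
        (trans (cong (resolve (tree t₀) comp₀) (sym (++-identityʳ b))) (resolve-shift b t comp ae ce []))
      shift (suc k) rewrite +-suc n k = trans (next (n + k))
        (trans (cong (resolve (tree t₀) comp₀) (trans (cong (_++ [ dir (n + k) ]) (shift k)) (++-assoc b (pos' k) _)))
               (resolve-shift b t comp ae ce _))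

      at-shift : ∀ k → at (tree t₀) (pos (n + k)) ≡ at t (pos' k)
      at-shift k = trans (cong (at (tree t₀)) (shift k)) (ae (pos' k))

      π' : Path t comp
      π' = record
        { pos = pos' ; dir = λ k → dir (n + k) ; start = refl
        ; step = λ k → ≡-subst (λ z → IsStep z _) (at-shift k) (step (n + k))
        ; next = λ k → refl }

      ∸-suc : ∀ k → suc (n + k) ∸ n ≡ suc k
      ∸-suc k = trans (cong (_∸ n) (sym (+-suc n k))) (m+n∸m≡n n (suc k))

      pair' : ∀ (τ : ℕ → TV) k → PairAt (at t (pos' k)) (dir (n + k)) (τ k) (τ (suc k)) →
              PairAt (at (tree t₀) (pos (n + k))) (dir (n + k)) (τ (n + k ∸ n)) (τ (suc (n + k) ∸ n))
      pair' τ k p rewrite m+n∸m≡n n k | ∸-suc k | at-shift k = p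

      prog' : ∀ (τ : ℕ → TV) k → ProgAt (at t (pos' k)) (dir (n + k)) (τ k) (τ (suc k)) →
              ProgAt (at (tree t₀) (pos (n + k))) (dir (n + k)) (τ (n + k ∸ n)) (τ (suc (n + k) ∸ n))
      prog' τ k p rewrite m+n∸m≡n n k | ∸-suc k | at-shift k = p

      pairs' : ∀ (τ : ℕ → TV) N → (∀ k → N ≤ k → PairAt (at t (pos' k)) (dir (n + k)) (τ k) (τ (suc k))) →
               ∀ k → n + N ≤ k → PairAt (at (tree t₀) (pos k)) (dir k) (τ (k ∸ n)) (τ (suc k ∸ n))
      pairs' τ N pairs k le with m≤n⇒∃[o]m+o≡n le
      ... | o , refl rewrite +-assoc n N o = pair' τ (N + o) (pairs (N + o) (m≤m+n N o))

    module _ (π : Path (tree t₀) comp₀) where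
      open Path π

      Followed : Set
      Followed = FollowedByProgressingTrace (tree t₀) comp₀ π

      EdgeFrom : ∀ {i k} → NodeAt i (pos k) → I → Set
      EdgeFrom {i} {k} nd j = Edge (NodeAt.r nd) (dir k) i j

      at-node : ∀ {i a} (nd : NodeAt i a) → at (tree t₀) a ≡ just (node (NodeAt.r nd) (trees (NodeAt.ts nd)))
      at-node nd = at-root (NodeAt.loc nd)

      -- Entering a finished premise settles the matter. Otherwise the path arrives at an annotated
      -- node: the child itself or, if that is a bud, the ancestor it points to.
      step-node : ∀ {i k} (nd : NodeAt i (pos k)) →
        Followed ⊎ Σ[ j ∈ I ] EdgeFrom {k = k} nd j × NodeAt j (pos (suc k))
      step-node {i} {k = k} nd@(nodeAt {ps = ps} {r = r} {e = e} ts l ls) with bound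
        where
        bound : dir k < length (trees ts)
        bound with step k
        ... | z rewrite at-node nd = z
      ... | d< with child ts (dir k) d<
      ... | done-child D p q =
        inj₁ (followed-by-suffix D (pos k ++ [ dir k ])
          (λ v → trans (child-at l (dir k) v) (p v)) (λ v → trans (child-comp l (dir k) v) (q _ _ v)) π (suc k) (next k))
      ... | more-child ed t p q = inj₂ (_ , ≡-subst (λ z → Edge r z i _) (+-identityʳ _) ed ,
              ≡-subst (NodeAt _) (sym (next k)) (arrive t
                (located (λ v → trans (child-at l (dir k) v) (p v)) (λ v → trans (child-comp l (dir k) v) (q _ _ v)))
                (child-env {e = e} {ts = ts} (dir k) d< l ls)))
        where
        arrive : ∀ {Ks j a} {env : Env Ks} (t : T Ks j) → Located a t env → LocatedEnv env →
                 NodeAt j (resolve (tree t₀) comp₀ a)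
        arrive {a = a} (back m) l ls rewrite at-root l | comp-root l = ancestor ls m
        arrive {a = a} (rule r e ts) l ls
          rewrite at-root l = nodeAt ts l ls

      module _ (t₀-node : NodeAt i₀ (pos 0)) (nf : ¬ Followed) where
        advance : ∀ {i k} (nd : NodeAt i (pos k)) → Σ[ j ∈ I ] EdgeFrom {k = k} nd j × NodeAt j (pos (suc k))
        advance {k = k} nd with step-node {k = k} nd
        ... | inj₁ f = ⊥-elim (nf f)
        ... | inj₂ s = s

        visit : ∀ k → Σ[ i ∈ I ] NodeAt i (pos k)
        visit zero = i₀ , t₀-node
        visit (suc k) = let (j , _ , nd) = advance {k = k} (proj₂ (visit k)) in j , nd

        run : Run
        run = (λ k → proj₁ (visit k)) ,
          λ k → _ , _ , NodeAt.r (proj₂ (visit k)) , dir k , proj₁ (proj₂ (advance {k = k} (proj₂ (visit k))))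

        follow-run : Traced run → Followed
        follow-run (τ , N , pairs , progs) = τ , N ,
          (λ k N≤k → pair k (pairs k N≤k)) ,
          λ M → let (k , M≤k , N≤k , p) = progs M in k , M≤k , N≤k , prog k p
          where
          pair : ∀ k → TracePair (NodeAt.r (proj₂ (visit k))) (dir k) (τ k) (τ (suc k)) →
                 PairAt (at (tree t₀) (pos k)) (dir k) (τ k) (τ (suc k))
          pair k p rewrite at-node (proj₂ (visit k)) = p
          prog : ∀ k → Progressing (NodeAt.r (proj₂ (visit k))) (dir k) (τ k) (τ (suc k)) →
                 ProgAt (at (tree t₀) (pos k)) (dir k) (τ k) (τ (suc k))
          prog k p rewrite at-node (proj₂ (visit k)) = p

  -- Excluded middle avoids asking whether a path ever enters a finished premise: a path without a
  -- trace never does, so it is a run, and runs have traces.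
  plug : (∀ R → Traced R) → ∀ {i} → T [] i → Derivableω (seqOf i)
  plug traced t@(rule r e ts) =
    tree t , comp₀ t , (wf-tree t , (λ u s eq → companions-ok t t loc₀ [] u s eq) , follow) , e
    where
    loc₀ = located (λ v → refl) (λ v → refl)
    follow : ∀ π → FollowedByProgressingTrace (tree t) (comp₀ t) π
    follow π with em {FollowedByProgressingTrace (tree t) (comp₀ t) π}
    ... | yes f = f
    ... | no nf = follow-run t π nd nf (traced (run t π nd nf))
      where
      nd = ≡-subst (NodeAt t _) (sym (Path.start π)) (nodeAt ts loc₀ [])

-- Lists, spines and structural rules

swap-⊆ : ∀ {A : Set} {a b : A} {xs} → (a ∷ b ∷ xs) ⊆ (b ∷ a ∷ xs)
swap-⊆ (here p) = there (here p)
swap-⊆ (there (here p)) = here p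
swap-⊆ (there (there p)) = there (there p)

swapL : ∀ {A B Γ Δ} → ((A ∷ B ∷ Γ) ⇒ Δ) ≈S ((B ∷ A ∷ Γ) ⇒ Δ)
swapL = (swap-⊆ , swap-⊆) , (id , id)

subL-self : ∀ x y → subL x y x ≡ y
subL-self x y = cong (if_then y else x) (≡ᵇ-refl x)
  where
  ≡ᵇ-refl : ∀ n → (n ≡ᵇ n) ≡ true
  ≡ᵇ-refl zero = refl
  ≡ᵇ-refl (suc n) = ≡ᵇ-refl n

boxes-++ : ∀ u v φ → boxes (u ++ v) φ ≡ boxes u (boxes v φ)
boxes-++ [] v φ = refl
boxes-++ (α ∷ u) v φ = cong (□[ α ]_) (boxes-++ u v φ)

absorb : ∀ {A : Set} {xs ys : List A} → xs ⊆ ys → (ys ++ xs) ⊆ ys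
absorb {ys = ys} s p with ∈-++⁻ ys p
... | inj₁ q = q
... | inj₂ q = s q

module _ (em : ExcludedMiddle 0ℓ) where

  -- With an empty `Edge` relation there are no runs, so every trace comes from one of the finished
  -- premises.
  derive : ∀ {ps c} → Rule ps c → All Derivableω ps → Derivableω c
  derive {c = c} r ds = plug (λ R → ⊥-elim (proj₂ (proj₂ (proj₂ (proj₂ (proj₂ R 0))))))
                     {tt} (rule r ≈-refl (dones ds))
    where
    open Plug em ⊤ (λ _ → c) (λ _ _ _ _ → ⊥)
    dones : ∀ {Ks n ps qs c} {r : Rule qs c} → All Derivableω ps → Ts Ks r tt n ps
    dones [] = []
    dones (d ∷ ds) = done d (dones ds)

  weakenL : ∀ Γ' {Γ Δ} → Derivableω (Γ ⇒ Δ) → Derivableω ((Γ' ++ Γ) ⇒ Δ)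
  weakenL [] d = d
  weakenL (A ∷ Γ') {Γ} {Δ} d = derive (wL A (Γ' ++ Γ) Δ) (weakenL Γ' d ∷ [])

  weakenR : ∀ Δ' {Γ Δ} → Derivableω (Γ ⇒ Δ) → Derivableω (Γ ⇒ (Δ' ++ Δ))
  weakenR [] d = d
  weakenR (A ∷ Δ') {Γ} {Δ} d = derive (wR A Γ (Δ' ++ Δ)) (weakenR Δ' d ∷ [])

  weaken : ∀ {Γ Γ' Δ Δ'} → Γ ⊆ Γ' → Δ ⊆ Δ' → Derivableω (Γ ⇒ Δ) → Derivableω (Γ' ⇒ Δ')
  weaken {Γ' = Γ'} {Δ' = Δ'} s t d =
    derivable-≈ ((absorb s , ∈-++⁺ˡ) , (absorb t , ∈-++⁺ˡ)) (weakenL Γ' (weakenR Δ' d))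

  identity : ∀ {A Γ Δ} → A ∈ Γ → A ∈ Δ → Derivableω (Γ ⇒ Δ)
  identity p q = weaken (λ { (here refl) → p }) (λ { (here refl) → q }) (derive (ax _) [])

-- Stack runs and their progressing traces

-- One rule step on the spine of the traced formula: only its first program changes.
data Move : List Pg → List Pg → Set where
  atom  : ∀ {a s} → Move (atom a ∷ s) s
  test  : ∀ {φ s} → Move ((φ ¿) ∷ s) s
  split : ∀ {α β s} → Move ((α ⨟ β) ∷ s) (α ∷ β ∷ s)
  left  : ∀ {α β s} → Move ((α ∪' β) ∷ s) (α ∷ s)
  right : ∀ {α β s} → Move ((α ∪' β) ∷ s) (β ∷ s)
  exit  : ∀ {γ s} → Move ((γ ⋆) ∷ s) s
  loop  : ∀ {γ s} → Move ((γ ⋆) ∷ s) (γ ∷ (γ ⋆) ∷ s)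

-- A move touches only the top of the stack, so a star in it survives unless it is itself on top and
-- is left by `exit`.
move-suffix : ∀ {u v γ s} pre → Move u v → u ≡ pre ++ (γ ⋆) ∷ s →
              v ≡ s ⊎ (Σ[ pre' ∈ List Pg ] v ≡ pre' ++ (γ ⋆) ∷ s)
move-suffix [] exit refl = inj₁ refl
move-suffix [] loop refl = inj₂ ([ _ ] , refl)
move-suffix (_ ∷ pre) atom refl = inj₂ (pre , refl)
move-suffix (_ ∷ pre) test refl = inj₂ (pre , refl)
move-suffix (_ ∷ pre) (split {α} {β}) refl = inj₂ (α ∷ β ∷ pre , refl)
move-suffix (_ ∷ pre) (left {α}) refl = inj₂ (α ∷ pre , refl)
move-suffix (_ ∷ pre) (right {β = β}) refl = inj₂ (β ∷ pre , refl)
move-suffix (_ ∷ pre) exit refl = inj₂ (pre , refl)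
move-suffix (_ ∷ pre) (loop {γ}) refl = inj₂ (γ ∷ (γ ⋆) ∷ pre , refl)

-- The spine is stored because `C` may begin with boxes of its own, and then the formula `boxes s C`
-- does not determine `s`.
record State : Set where
  constructor state
  field
    context : List Item
    label   : Label
    spineOf : List Pg
    fuel    : ℕ
open State

module Traces (em : ExcludedMiddle 0ℓ) (C : Fm) where

  seqOf : State → Seq
  seqOf (state Γ z s _) = Γ ⇒ [ z ∶ boxes s C ]

  -- Each star in the spine gives a reading of the succedent as a trace value. Which reading
  -- progresses depends on the whole path, so `Edge` asks for trace pairs for all of them.
  value : State → List Pg → Pg → List Pg → TV
  value i pre γ s = tv (label i) pre γ (boxes s C)

  -- The fuel bounds the number of consecutive edges that leave the traced formula alone.
  record Edge {ps c} (r : Rule ps c) (d : ℕ) (i j : State) : Set where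
    constructor mkEdge
    field
      step  : (spineOf j ≡ spineOf i × fuel j < fuel i) ⊎
              (Move (spineOf i) (spineOf j) × principalR r ≡ just (label i ∶ boxes (spineOf i) C))
      pairs : ∀ pre pre' γ s → spineOf i ≡ pre ++ (γ ⋆) ∷ s → spineOf j ≡ pre' ++ (γ ⋆) ∷ s →
              TracePair r d (value i pre γ s) (value j pre' γ s)

  open Plug em State seqOf Edge public

  module _ (R : Run) where
    private
      ι = proj₁ R
      ρ = proj₂ R

      sp : ℕ → List Pg
      sp k = spineOf (ι k)

    edge : ∀ k → let (_ , _ , r , d , _) = ρ k in Edge r d (ι k) (ι (suc k))
    edge k = proj₂ (proj₂ (proj₂ (proj₂ (ρ k))))

    Principal : ℕ → Set
    Principal k = principalR (proj₁ (proj₂ (proj₂ (ρ k)))) ≡ just (label (ι k) ∶ boxes (sp k) C)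

    -- Edges that keep the spine lower the fuel, so only finitely many of them come in a row.
    next-move : ∀ n → Σ[ k ∈ ℕ ] n ≤ k × sp k ≡ sp n × Move (sp k) (sp (suc k)) × Principal k
    next-move n = go (suc (fuel (ι n))) n ≤-refl
      where
      go : ∀ f n → fuel (ι n) < f → Σ[ k ∈ ℕ ] n ≤ k × sp k ≡ sp n × Move (sp k) (sp (suc k)) × Principal k
      go (suc f) n n<f with Edge.step (edge n)
      ... | inj₂ (mv , pr) = n , ≤-refl , refl , mv , pr
      ... | inj₁ (e , lt) with go f (suc n) (<-≤-trans lt (≤-pred n<f))
      ... | k , le , e' , mv = k , ≤-trans (n≤1+n n) le , trans e' e , mv

    Passes : List Pg → ℕ → Set
    Passes s n = Σ[ k ∈ ℕ ] n ≤ k × sp k ≡ s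

    -- While the run stays above γ ⋆ ∷ s, cut the spine there: what lies above is the spine
    -- of the trace value, and it is empty infinitely often.
    module Stuck {γ s n} (never : ¬ Passes s n)
                 (start : sp n ≡ (γ ⋆) ∷ s)
                 (again : ∀ k → n ≤ k → sp k ≡ (γ ⋆) ∷ s → Passes ((γ ⋆) ∷ s) (suc k)) where

      Above : ℕ → Set
      Above k = Σ[ pre ∈ List Pg ] sp k ≡ pre ++ (γ ⋆) ∷ s

      above-suc : ∀ k → n ≤ k → Above k → Above (suc k)
      above-suc k n≤k (pre , e) with Edge.step (edge k)
      ... | inj₁ (e' , _) = pre , trans e' e
      ... | inj₂ (mv , _) with move-suffix pre mv e
      ... | inj₁ e' = ⊥-elim (never (suc k , ≤-trans n≤k (n≤1+n k) , e'))
      ... | inj₂ a = a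

      above : ∀ k → n ≤ k → Above k
      above k n≤k with m≤n⇒m<n∨m≡n n≤k
      ... | inj₂ refl = [] , start
      above (suc k) _ | inj₁ (s≤s n≤k) = above-suc k n≤k (above k n≤k)

      -- A trace value is due at every index, also before `n`, where the star may be absent; `[]` is
      -- the dummy for that case.
      prefix : ∀ k → Σ[ pre ∈ List Pg ] (n ≤ k → sp k ≡ pre ++ (γ ⋆) ∷ s)
      prefix k with em {Above k}
      ... | yes (pre , e) = pre , λ _ → e
      ... | no ¬a = [] , λ n≤k → ⊥-elim (¬a (above k n≤k))

      recurs : ∀ M → Σ[ k ∈ ℕ ] M ≤ k × n ≤ k × sp k ≡ (γ ⋆) ∷ s
      recurs zero = n , z≤n , ≤-refl , start
      recurs (suc M) with recurs M
      ... | k , M≤k , n≤k , e with again k n≤k e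
      ... | k' , k<k' , e' = k' , ≤-trans (s≤s M≤k) k<k' , ≤-trans n≤k (≤-trans (n≤1+n k) k<k') , e'

      traced : Traced R
      traced = (λ k → value (ι k) (proj₁ (prefix k)) γ s) , n , pairs , progress
        where
        pairs : ∀ k → n ≤ k → TracePair _ _ _ _
        pairs k n≤k = Edge.pairs (edge k) _ _ γ s (proj₂ (prefix k) n≤k)
                        (proj₂ (prefix (suc k)) (≤-trans n≤k (n≤1+n k)))
        progress : ∀ M → Σ[ k ∈ ℕ ] M ≤ k × n ≤ k × _
        progress M with recurs M
        -- The return at `k₀` may be followed by steps that keep the spine. Progress happens at the
        -- next move, when the star is principal with nothing above it.
        ... | k₀ , M≤k₀ , n≤k₀ , e₀ with next-move k₀
        ... | k , k₀≤k , e , _ , pr =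
          k , ≤-trans M≤k₀ k₀≤k , n≤k , pairs k n≤k ,
          trans pr (cong (λ F → just (label (ι k) ∶ F)) (trans (cong (λ u → boxes u C) (proj₂ (prefix k) n≤k))
            (boxes-++ (proj₁ (prefix k)) ((γ ⋆) ∷ s) C))) ,
          ++-cancelʳ ((γ ⋆) ∷ s) (proj₁ (prefix k)) [] (trans (sym (proj₂ (prefix k) n≤k)) (trans e e₀))
          where
          n≤k = ≤-trans n≤k₀ k₀≤k

    moves-from : ∀ {n u} → sp n ≡ u → Σ[ k ∈ ℕ ] n ≤ k × Move u (sp (suc k))
    moves-from {n} refl with next-move n
    ... | k , le , e , mv , _ = k , le , ≡-subst (λ u → Move u (sp (suc k))) e mv

    private
      later : ∀ {n k s} → n ≤ k → Traced R ⊎ Passes s (suc k) → Traced R ⊎ Passes s n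
      later le = map₂ λ { (k' , le' , e) → k' , ≤-trans le (≤-trans (n≤1+n _) le') , e }

    -- Induction on `γ`: its components are popped in turn. If a star is never popped, every move at
    -- it is a `loop`, and by induction the pushed body is popped again; so the star recurs at the
    -- same height and `Stuck` applies.
    pass : ∀ γ s n → sp n ≡ γ ∷ s → Traced R ⊎ Passes s n
    pass (atom a) s n e with moves-from e
    ... | k , le , mv = later le (inj₂ (suc k , ≤-refl , inv mv))
      where inv : ∀ {a s v} → Move (atom a ∷ s) v → v ≡ s
            inv atom = refl
    pass (φ ¿) s n e with moves-from e
    ... | k , le , mv = later le (inj₂ (suc k , ≤-refl , inv mv))
      where inv : ∀ {φ s v} → Move ((φ ¿) ∷ s) v → v ≡ s
            inv test = refl
    pass (α ⨟ β) s n e with moves-from e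
    ... | k , le , mv with pass α (β ∷ s) (suc k) (inv mv)
      where inv : ∀ {α β s v} → Move ((α ⨟ β) ∷ s) v → v ≡ α ∷ β ∷ s
            inv split = refl
    ... | inj₁ t = inj₁ t
    ... | inj₂ (k' , le' , e') with pass β s k' e'
    ... | inj₁ t = inj₁ t
    ... | inj₂ (k″ , le″ , e″) = later le (inj₂ (k″ , ≤-trans le' le″ , e″))
    pass (α ∪' β) s n e with moves-from e
    ... | k , le , mv with inv mv
      where inv : ∀ {α β s v} → Move ((α ∪' β) ∷ s) v → v ≡ α ∷ s ⊎ v ≡ β ∷ s
            inv left = inj₁ refl
            inv right = inj₂ refl
    ... | inj₁ e' = later le (pass α s (suc k) e')
    ... | inj₂ e' = later le (pass β s (suc k) e')
    pass (γ ⋆) s n e with em {Traced R}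
    ... | yes t = inj₁ t
    ... | no ¬t with em {Passes s n}
    ... | yes p = inj₂ p
    ... | no never = inj₁ (Stuck.traced never e again)
      where
      inv : ∀ {γ s v} → Move ((γ ⋆) ∷ s) v → v ≡ s ⊎ v ≡ γ ∷ (γ ⋆) ∷ s
      inv exit = inj₁ refl
      inv loop = inj₂ refl
      again : ∀ k → n ≤ k → sp k ≡ (γ ⋆) ∷ s → Passes ((γ ⋆) ∷ s) (suc k)
      again k n≤k e' with moves-from e'
      ... | k' , le , mv with inv mv
      ... | inj₁ e″ = ⊥-elim (never (suc k' , ≤-trans n≤k (≤-trans le (n≤1+n k')) , e″))
      ... | inj₂ e″ with pass γ ((γ ⋆) ∷ s) (suc k') e″
      ... | inj₁ t = ⊥-elim (¬t t)
      ... | inj₂ (k″ , le' , e‴) = k″ , ≤-trans (s≤s le) le' , e‴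

    -- Popping every program would leave the empty spine, which has no move although `next-move`
    -- always finds one. Hence `pass` yields a trace at some entry.
    run-traced : Traced R
    run-traced = go (sp 0) 0 refl
      where
      go : ∀ u n → sp n ≡ u → Traced R
      go [] n e with moves-from e
      ... | _ , _ , ()
      go (γ ∷ s) n e with pass γ s n e
      ... | inj₁ t = t
      ... | inj₂ (k , _ , e') = go s k e'

-- Trace pairs for the two kinds of edges

module Edges (em : ExcludedMiddle 0ℓ) (C : Fm) where
  open Traces em C public

  spine-∈ : ∀ {z Γ} pre {b s} → s ≡ pre ++ b → (z ∶ boxes s C) ∈ Γ → (z ∶ boxes pre (boxes b C)) ∈ Γ
  spine-∈ pre {b} refl m = ≡-subst (λ F → (_ ∶ F) ∈ _) (boxes-++ pre b C) m

  -- With equal spines, two cuts above the same star have the same prefix, so the trace value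
  -- changes at most its label.
  keep-edge : ∀ {ps c} {r : Rule ps c} {d Γ z m Γ' z' m' s} → principalR r ≡ nothing → m' < m →
    (z ∶ boxes s C) ∈ succ c → (z' ∶ boxes s C) ∈ premSucc ps d →
    (∀ pre γ φ → NonPrinPair r (tv z pre γ φ) (tv z' pre γ φ)) →
    Edge r d (state Γ z s m) (state Γ' z' s m')
  keep-edge pr lt e e' np = mkEdge (inj₁ (refl , lt)) pairs
    where
    pairs : ∀ pre pre' γ s → _ → _ → TracePair _ _ _ _
    pairs pre pre' γ s q q' with ++-cancelʳ ((γ ⋆) ∷ s) pre pre' (trans (sym q) q')
    ... | refl = spine-∈ pre q e , spine-∈ pre q' e' ,
      inj₂ ((λ p → case-nothing (trans (sym pr) p)) , np pre γ _)
      where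
      case-nothing : ∀ {A : Set} {a : A} → nothing ≡ just a → ⊥
      case-nothing ()

  move-edge : ∀ {ps c} {r : Rule ps c} {d Γ z m Γ' z' m' s s'} → Move s s' →
    principalR r ≡ just (z ∶ boxes s C) → (z ∶ boxes s C) ∈ succ c → (z' ∶ boxes s' C) ∈ premSucc ps d →
    (∀ pre pre' γ t → s ≡ pre ++ (γ ⋆) ∷ t → s' ≡ pre' ++ (γ ⋆) ∷ t →
      PrinPair r d (tv z pre γ (boxes t C)) (tv z' pre' γ (boxes t C))) →
    Edge r d (state Γ z s m) (state Γ' z' s' m')
  move-edge mv pr e e' pp = mkEdge (inj₂ (mv , pr)) λ pre pre' γ t q q' →
    spine-∈ pre q e , spine-∈ pre' q' e' ,
    inj₁ (trans pr (cong (λ F → just (_ ∶ F)) (trans (cong (λ u → boxes u C) q) (boxes-++ pre ((γ ⋆) ∷ t) C))) , pp pre pre' γ t q q')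

  popped : ∀ {δ} {s b : List Pg} pre pre' → δ ∷ s ≡ pre ++ b → s ≡ pre' ++ b → pre ≡ δ ∷ pre'
  popped {δ} {b = b} pre pre' q q' = ++-cancelʳ b pre (δ ∷ pre') (trans (sym q) (cong (δ ∷_) q'))

  -- A top program other than the star being followed lies above the cut, so replacing it affects
  -- only the prefix.
  swap-top : ∀ {δ s γ t} u pre pre' → ¬ (δ ≡ γ ⋆) → δ ∷ s ≡ pre ++ (γ ⋆) ∷ t →
             u ++ s ≡ pre' ++ (γ ⋆) ∷ t → Σ[ p ∈ List Pg ] pre ≡ δ ∷ p × pre' ≡ u ++ p
  swap-top u [] pre' n q q' = ⊥-elim (n (∷-injectiveˡ q))
  swap-top {γ = γ} {t} u (_ ∷ p) pre' n refl q' =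
    p , refl , ++-cancelʳ ((γ ⋆) ∷ t) pre' (u ++ p) (trans (sym q') (sym (++-assoc u p _)))

-- The loop rule as a cyclic derivation

module _ (em : ExcludedMiddle 0ℓ) (x : Label) (C : Fm) where
  open Edges em C

  private
    y = suc x

    main : Fm → List Pg → State
    main A s = state [ x ∶ A ] x s 0

    -- The premise x : A ⇒ x : boxes s C is supplied as a continuation, valid below any further ancestors.
    Cont : List State → Fm → List Pg → Set
    Cont Ks A s = ∀ {Ks'} → Ks ⊆ Ks' → T Ks' (main A s)

  -- Each program is taken apart first on the right, then on the left, until `A` faces `boxes s C`.
  -- This leaf can occur in several branches with different ancestors, hence the continuation.
  block : ∀ γ A s {Ks} → Cont Ks A s → T Ks (main (□[ γ ] A) (γ ∷ s))
  block (atom a) A s k =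
    rule (boxR x a y (boxes s C) [ x ∶ (□[ atom a ] A) ] [] fresh) ≈-refl
      -- The fuel counts the spine-keeping steps left before the next `main`, which has fuel 0; a
      -- move may reset it.
      (more (state ((x ⟶[ a ] y) ∷ [ x ∶ (□[ atom a ] A) ]) y s 2) ≈-refl
        (move-edge atom refl (here refl) (here refl)
          λ pre pre' γ t q q' → cong (y ∶_) (trans (sym (boxes-++ pre' ((γ ⋆) ∷ t) C)) (cong (λ u → boxes u C) (sym q'))) ,
            cong (λ u → tv x u γ _) (popped pre pre' q q'))
        (rule (boxL x a y A [] [ y ∶ boxes s C ]) swapL
          (more (state [ y ∶ A ] y s 1) ≈-refl
            (keep-edge refl ≤-refl (here refl) (here refl) (λ _ _ _ → refl))
            -- Read upwards, the substitution returns from the fresh label to `x`, so that back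
            -- edges can meet an identical sequent.
            (rule (subst x y [ x ∶ A ] [ x ∶ boxes s C ]) subst-≈
              (more (main A s) ≈-refl
                (keep-edge refl ≤-refl (here (cong (_∶ _) (sym (subL-self x y)))) (here refl)
                  (λ pre γ φ → cong (λ z → tv z pre γ φ) (sym (subL-self x y))))
                (k (there ∘ there ∘ there)) [])) [])) [])
    where
    fresh : Fresh y ([ x ∶ (□[ atom a ] A) ] ⇒ [ x ∶ (□[ atom a ] boxes s C) ])
    fresh (here p) = 1+n≢n p
    fresh (there (here p)) = 1+n≢n p
    subst-≈ : ([ subL x y x ∶ A ] ⇒ [ subL x y x ∶ boxes s C ]) ≈S ([ y ∶ A ] ⇒ [ y ∶ boxes s C ])
    subst-≈ rewrite subL-self x y = ≈-refl
  block (α ⨟ β) A s k =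
    rule (seqR x α β (boxes s C) [ x ∶ (□[ α ⨟ β ] A) ] []) ≈-refl
      (more (state [ x ∶ (□[ α ⨟ β ] A) ] x (α ∷ β ∷ s) 1) ≈-refl
        (move-edge split refl (here refl) (here refl) pair)
        (rule (seqL x α β A [] [ x ∶ boxes (α ∷ β ∷ s) C ]) ≈-refl
          (more (main (□[ α ] □[ β ] A) (α ∷ β ∷ s)) ≈-refl
            (keep-edge refl ≤-refl (here refl) (here refl) (λ _ _ _ → refl))
            (block α (□[ β ] A) (β ∷ s) λ σ → block β A s λ σ' → k (σ' ∘ σ ∘ there ∘ there)) [])) [])
    where
    pair : ∀ pre pre' γ t → (α ⨟ β) ∷ s ≡ pre ++ (γ ⋆) ∷ t → α ∷ β ∷ s ≡ pre' ++ (γ ⋆) ∷ t → _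
    pair pre pre' γ t q q' with swap-top (α ∷ β ∷ []) pre pre' (λ ()) q q'
    ... | p , refl , refl = p , refl , refl
  block (α ∪' β) A s k =
    rule (unionR x α β (boxes s C) [ x ∶ (□[ α ∪' β ] A) ] []) ≈-refl
      (more (state [ x ∶ (□[ α ∪' β ] A) ] x (α ∷ s) 2) ≈-refl
        (move-edge left refl (here refl) (here refl) pairˡ)
        (rule (unionL x α β A [] [ x ∶ boxes (α ∷ s) C ]) ≈-refl
          (more (state ((x ∶ (□[ α ] A)) ∷ (x ∶ (□[ β ] A)) ∷ []) x (α ∷ s) 1) ≈-refl
            (keep-edge refl ≤-refl (here refl) (here refl) (λ _ _ _ → refl))
            (rule (wL (x ∶ (□[ β ] A)) [ x ∶ (□[ α ] A) ] [ x ∶ boxes (α ∷ s) C ]) swapL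
              (more (main (□[ α ] A) (α ∷ s)) ≈-refl
                (keep-edge refl ≤-refl (here refl) (here refl) (λ _ _ _ → refl))
                (block α A s λ σ → k (σ ∘ there ∘ there ∘ there)) [])) []))
      (more (state [ x ∶ (□[ α ∪' β ] A) ] x (β ∷ s) 2) ≈-refl
        (move-edge right refl (here refl) (here refl) pairʳ)
        (rule (unionL x α β A [] [ x ∶ boxes (β ∷ s) C ]) ≈-refl
          (more (state ((x ∶ (□[ α ] A)) ∷ (x ∶ (□[ β ] A)) ∷ []) x (β ∷ s) 1) ≈-refl
            (keep-edge refl ≤-refl (here refl) (here refl) (λ _ _ _ → refl))
            (rule (wL (x ∶ (□[ α ] A)) [ x ∶ (□[ β ] A) ] [ x ∶ boxes (β ∷ s) C ]) ≈-refl
              (more (main (□[ β ] A) (β ∷ s)) ≈-refl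
                (keep-edge refl ≤-refl (here refl) (here refl) (λ _ _ _ → refl))
                (block β A s λ σ → k (σ ∘ there ∘ there ∘ there)) [])) [])) []))
    where
    pairˡ : ∀ pre pre' γ t → (α ∪' β) ∷ s ≡ pre ++ (γ ⋆) ∷ t → α ∷ s ≡ pre' ++ (γ ⋆) ∷ t → _
    pairˡ pre pre' γ t q q' with swap-top (α ∷ []) pre pre' (λ ()) q q'
    ... | p , refl , refl = p , refl , refl
    pairʳ : ∀ pre pre' γ t → (α ∪' β) ∷ s ≡ pre ++ (γ ⋆) ∷ t → β ∷ s ≡ pre' ++ (γ ⋆) ∷ t → _
    pairʳ pre pre' γ t q q' with swap-top (β ∷ []) pre pre' (λ ()) q q'
    ... | p , refl , refl = p , refl , refl
  block (φ ¿) A s k =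
    rule (testR x φ (boxes s C) [ x ∶ (□[ φ ¿ ] A) ] []) ≈-refl
      (more (state ((x ∶ φ) ∷ (x ∶ (□[ φ ¿ ] A)) ∷ []) x s 2) ≈-refl
        (move-edge test refl (here refl) (here refl)
          λ pre pre' γ t q q' → cong (λ u → tv x u γ _) (popped pre pre' q q'))
        (rule (testL x φ A [ x ∶ φ ] [ x ∶ boxes s C ]) swapL
          (done (identity em (here refl) (here refl))
          (more (state ((x ∶ A) ∷ (x ∶ φ) ∷ []) x s 1) ≈-refl
            (keep-edge refl ≤-refl (here refl) (here refl) (λ _ _ _ → refl))
            (rule (wL (x ∶ φ) [ x ∶ A ] [ x ∶ boxes s C ]) swapL
              (more (main A s) ≈-refl
                (keep-edge refl ≤-refl (here refl) (here refl) (λ _ _ _ → refl))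
                (k (there ∘ there ∘ there)) [])) []))) [])
  block (γ ⋆) A s k =
    rule (starR x γ (boxes s C) [ x ∶ (□[ γ ⋆ ] A) ] []) ≈-refl
      (more (state [ x ∶ (□[ γ ⋆ ] A) ] x s 2) ≈-refl
        (move-edge exit refl (here refl) (here refl)
          λ pre pre' δ t q q' → cong (λ u → tv x u δ _) (popped pre pre' q q'))
        (rule (starL x γ A [] [ x ∶ boxes s C ]) ≈-refl
          (more (state ((x ∶ A) ∷ (x ∶ (□[ γ ] □[ γ ⋆ ] A)) ∷ []) x s 1) ≈-refl
            (keep-edge refl ≤-refl (here refl) (here refl) (λ _ _ _ → refl))
            (rule (wL (x ∶ (□[ γ ] □[ γ ⋆ ] A)) [ x ∶ A ] [ x ∶ boxes s C ]) swapL
              (more (main A s) ≈-refl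
                (keep-edge refl ≤-refl (here refl) (here refl) (λ _ _ _ → refl))
                (k (there ∘ there ∘ there)) [])) []))
      (more (state [ x ∶ (□[ γ ⋆ ] A) ] x (γ ∷ (γ ⋆) ∷ s) 2) ≈-refl
        (move-edge loop refl (here refl) (here refl)
          λ pre pre' δ t q q' → cong (λ u → tv x u δ _) (popped pre' pre q' q))
        (rule (starL x γ A [] [ x ∶ boxes (γ ∷ (γ ⋆) ∷ s) C ]) ≈-refl
          (more (state ((x ∶ A) ∷ (x ∶ (□[ γ ] □[ γ ⋆ ] A)) ∷ []) x (γ ∷ (γ ⋆) ∷ s) 1) ≈-refl
            (keep-edge refl ≤-refl (here refl) (here refl) (λ _ _ _ → refl))
            (rule (wL (x ∶ A) [ x ∶ (□[ γ ] □[ γ ⋆ ] A) ] [ x ∶ boxes (γ ∷ (γ ⋆) ∷ s) C ]) ≈-refl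
              (more (main (□[ γ ] □[ γ ⋆ ] A) (γ ∷ (γ ⋆) ∷ s)) ≈-refl
                (keep-edge refl ≤-refl (here refl) (here refl) (λ _ _ _ → refl))
                -- Once the body is popped, the sequent is again the conclusion of `starR` above;
                -- the index skips the nodes of `wL` and `starL`, and `σ` those of the inner block.
                (block γ (□[ γ ⋆ ] A) ((γ ⋆) ∷ s) λ σ → back (σ (there (there (here refl))))) [])) [])) []))

  -- A cut with the invariant turns the right premise of `starR` into `[α]A` against `[α][α⋆]C`.
  -- Pushing both down with `block` returns to the root sequent, where a back edge closes the cycle.
  loop-rule : ∀ α A → Derivableω ([ x ∶ A ] ⇒ [ x ∶ C ]) →
              Derivableω ([ x ∶ A ] ⇒ [ x ∶ (□[ α ] A) ]) →
              Derivableω ([ x ∶ A ] ⇒ [ x ∶ (□[ α ⋆ ] C) ])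
  loop-rule α A base invariant = plug run-traced {main A [ α ⋆ ]}
    (rule (starR x α C [ x ∶ A ] []) ≈-refl
      (done base
      (more (state [ x ∶ A ] x (α ∷ [ α ⋆ ]) 1) ≈-refl
        (move-edge loop refl (here refl) (here refl)
          λ pre pre' δ t q q' → cong (λ u → tv x u δ _) (popped pre' pre q' q))
        (rule (cut (x ∶ (□[ α ] A)) [ x ∶ A ] [] [] [ x ∶ boxes (α ∷ [ α ⋆ ]) C ]) ≈-refl
          (done invariant
          (more (main (□[ α ] A) (α ∷ [ α ⋆ ])) ≈-refl
            (keep-edge refl ≤-refl (here refl) (here refl) (λ _ _ _ → refl))
            (block α A [ α ⋆ ] λ σ → back (σ (there (here refl)))) []))) [])))

-- Derived rules at one label, and descriptions of worlds

module Entailment (em : ExcludedMiddle 0ℓ) (x : Label) where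

  infix 2 _⊢_
  _⊢_ : List Fm → List Fm → Set
  Γ ⊢ Δ = Derivableω (map (x ∶_) Γ ⇒ map (x ∶_) Δ)

  thin : ∀ {Γ Γ' Δ Δ'} → Γ ⊆ Γ' → Δ ⊆ Δ' → Γ ⊢ Δ → Γ' ⊢ Δ'
  thin s t = weaken em (⊆-map⁺ (x ∶_) s) (⊆-map⁺ (x ∶_) t)

  hyp : ∀ {A Γ Δ} → A ∈ Γ → A ∈ Δ → Γ ⊢ Δ
  hyp p q = identity em (∈-map⁺ (x ∶_) p) (∈-map⁺ (x ∶_) q)

  ⊢-cut : ∀ {Γ Δ} A → Γ ⊢ A ∷ Δ → A ∷ Γ ⊢ Δ → Γ ⊢ Δ
  ⊢-cut A d e = derivable-≈ ((absorb id , ∈-++⁺ˡ) , (absorb id , ∈-++⁺ˡ)) (derive em (cut (x ∶ A) _ _ _ _) (d ∷ e ∷ []))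

  chain : ∀ {Γ A B} → Γ ⊢ [ A ] → [ A ] ⊢ [ B ] → Γ ⊢ [ B ]
  chain {A = A} d e = ⊢-cut A (thin id (λ { (here p) → here p }) d) (thin (λ { (here p) → here p }) id e)

  ⊥L : ∀ {Γ Δ} → ⊥' ∷ Γ ⊢ Δ
  ⊥L = weaken em (λ { (here p) → here p }) (λ ()) (derive em (botL x) [])

  ∧L : ∀ {A B Γ Δ} → A ∷ B ∷ Γ ⊢ Δ → A ∧' B ∷ Γ ⊢ Δ
  ∧L d = derive em (andL x _ _ _ _) (d ∷ [])

  ∧R : ∀ {A B Γ Δ} → Γ ⊢ A ∷ Δ → Γ ⊢ B ∷ Δ → Γ ⊢ A ∧' B ∷ Δ
  ∧R d e = derive em (andR x _ _ _ _) (d ∷ e ∷ [])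

  ∨L : ∀ {A B Γ Δ} → A ∷ Γ ⊢ Δ → B ∷ Γ ⊢ Δ → (A ∨' B) ∷ Γ ⊢ Δ
  ∨L d e = derive em (orL x _ _ _ _) (d ∷ e ∷ [])

  ∨R : ∀ {A B Γ Δ} → Γ ⊢ A ∷ B ∷ Δ → Γ ⊢ (A ∨' B) ∷ Δ
  ∨R d = derive em (orR x _ _ _ _) (d ∷ [])

  ⇒L : ∀ {A B Γ Δ} → Γ ⊢ A ∷ Δ → B ∷ Γ ⊢ Δ → (A ⇒' B) ∷ Γ ⊢ Δ
  ⇒L d e = derive em (impL x _ _ _ _) (d ∷ e ∷ [])

  ⇒R : ∀ {A B Γ Δ} → A ∷ Γ ⊢ B ∷ Δ → Γ ⊢ (A ⇒' B) ∷ Δ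
  ⇒R d = derive em (impR x _ _ _ _) (d ∷ [])

  private
    y = suc x

  y-fresh : ∀ Γ Δ → Fresh y (map (x ∶_) Γ ⇒ map (x ∶_) Δ)
  y-fresh (_ ∷ Γ) Δ (here p) = 1+n≢n p
  y-fresh (_ ∷ Γ) Δ (there p) = y-fresh Γ Δ p
  y-fresh [] (_ ∷ Δ) (here p) = 1+n≢n p
  y-fresh [] (_ ∷ Δ) (there p) = y-fresh [] Δ p

  necessitation : ∀ a {F} → [] ⊢ [ F ] → [] ⊢ [ □[ atom a ] F ]
  necessitation a {F} d = derive em (boxR x a y F [] [] (y-fresh [] [ □[ atom a ] F ]))
    (derive em (wL _ _ _)
      (≡-subst (λ z → Derivableω ([] ⇒ [ z ∶ F ])) (subL-self x y) (derive em (subst x y [] [ x ∶ F ]) (d ∷ [])) ∷ []) ∷ [])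

  -- Axiom K. `boxL` consumes its relational atom, so the first use keeps a second copy in the
  -- context; as sets the sequents agree.
  distribution : ∀ a {F G} → (□[ atom a ] (G ⇒' F)) ∷ (□[ atom a ] G) ∷ [] ⊢ [ □[ atom a ] F ]
  distribution a {F} {G} = derive em (boxR x a y F _ [] (y-fresh (_ ∷ _ ∷ []) [ □[ atom a ] F ]))
    (derivable-≈ ((into₁ , from₁) , (id , id)) (derive em (boxL x a y (G ⇒' F) ((x ⟶[ a ] y) ∷ (x ∶ (□[ atom a ] G)) ∷ []) _)
      (derivable-≈ ((into₂ , from₂) , (id , id)) (derive em (boxL x a y G [ y ∶ (G ⇒' F) ] _)
        (derivable-≈ swapL (derive em (impL y G F [ y ∶ G ] [ y ∶ F ])
          (identity em (here refl) (here refl) ∷ identity em (here refl) (here refl) ∷ [])) ∷ [])) ∷ [])) ∷ [])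
    where
    into₁ : ∀ {A : Set} {p q r : A} → (p ∷ q ∷ q ∷ r ∷ []) ⊆ (q ∷ p ∷ r ∷ [])
    into₁ (here e) = there (here e)
    into₁ (there (here e)) = here e
    into₁ (there (there (here e))) = here e
    into₁ (there (there (there (here e)))) = there (there (here e))
    from₁ : ∀ {A : Set} {p q r : A} → (q ∷ p ∷ r ∷ []) ⊆ (p ∷ q ∷ q ∷ r ∷ [])
    from₁ (here e) = there (here e)
    from₁ (there (here e)) = here e
    from₁ (there (there (here e))) = there (there (there (here e)))
    into₂ : ∀ {A : Set} {p q r : A} → (p ∷ q ∷ r ∷ []) ⊆ (r ∷ q ∷ p ∷ [])
    into₂ (here e) = there (there (here e))
    into₂ (there (here e)) = there (here e)
    into₂ (there (there (here e))) = here e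
    from₂ : ∀ {A : Set} {p q r : A} → (r ∷ q ∷ p ∷ []) ⊆ (p ∷ q ∷ r ∷ [])
    from₂ = into₂

  -- The members of `Γ` become antecedents of nested implications; these are necessitated and the
  -- box is then distributed over each in turn.
  box-mono : ∀ a {A F} Γ → Γ ⊢ [ F ] → (∀ {G} → G ∈ Γ → [ A ] ⊢ [ □[ atom a ] G ]) →
             [ A ] ⊢ [ □[ atom a ] F ]
  box-mono a [] d h = thin (λ ()) id (necessitation a d)
  box-mono a {A} {F} (G ∷ Γ) d h =
    ⊢-cut (□[ atom a ] (G ⇒' F)) (thin id (λ { (here p) → here p }) (box-mono a Γ (⇒R d) (h ∘ there)))
      (⊢-cut (□[ atom a ] G) (thin there (λ { (here p) → here p }) (h (here refl)))
        (thin (λ { (here p) → there (here p) ; (there (here p)) → here p }) id (distribution a)))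

  neg : Fm → Fm
  neg A = A ⇒' ⊥'

  disj : List Fm → Fm
  disj [] = ⊥'
  disj (A ∷ As) = A ∨' disj As

  disj-intro : ∀ {A As} → A ∈ As → [ A ] ⊢ [ disj As ]
  disj-intro (here refl) = ∨R (hyp (here refl) (here refl))
  disj-intro (there p) = ∨R (thin id there (disj-intro p))

  disj-elim : ∀ As {Δ} → (∀ {A} → A ∈ As → [ A ] ⊢ Δ) → [ disj As ] ⊢ Δ
  disj-elim [] h = ⊥L
  disj-elim (A ∷ As) h = ∨L (h (here refl)) (disj-elim As (h ∘ there))

  -- Stand-ins for the subsets of `Φ`; the closing `neg ⊥'` is the empty conjunction.
  descriptions : List Fm → List Fm
  descriptions [] = [ neg ⊥' ]
  descriptions (φ ∷ Φ) = map (φ ∧'_) (descriptions Φ) ++ map (neg φ ∧'_) (descriptions Φ)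

  exhaustive : ∀ Φ {Γ Δ} → (∀ {A} → A ∈ descriptions Φ → A ∷ Γ ⊢ Δ) → Γ ⊢ Δ
  exhaustive [] h = ⊢-cut (neg ⊥') (⇒R ⊥L) (h (here refl))
  exhaustive (φ ∷ Φ) {Γ} {Δ} h = ⊢-cut (neg φ)
    (⇒R (thin id (λ p → there p) (exhaustive Φ λ {A} m → given φ (h (∈-++⁺ˡ (∈-map⁺ (φ ∧'_) m))))))
    (exhaustive Φ λ {A} m → given (neg φ) (h (∈-++⁺ʳ (map (φ ∧'_) (descriptions Φ)) (∈-map⁺ (neg φ ∧'_) m))))
    where
    given : ∀ ψ {A} → ψ ∧' A ∷ Γ ⊢ Δ → A ∷ ψ ∷ Γ ⊢ Δ
    given ψ {A} d = ⊢-cut (ψ ∧' A) (∧R (hyp (there (here refl)) (here refl)) (hyp (here refl) (here refl)))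
      (thin (λ { (here p) → here p ; (there p) → there (there (there p)) }) id d)

  decides : ∀ {Φ A φ} → A ∈ descriptions Φ → φ ∈ Φ → ([ A ] ⊢ [ φ ]) ⊎ (φ ∷ A ∷ [] ⊢ [])
  decides {ψ ∷ Φ} m q with ∈-++⁻ (map (ψ ∧'_) (descriptions Φ)) m
  decides {ψ ∷ Φ} m q | inj₁ m' with ∈-map⁻ (ψ ∧'_) m'
  decides m (here refl) | inj₁ _ | B , n , refl = inj₁ (∧L (hyp (here refl) (here refl)))
  decides m (there q) | inj₁ _ | B , n , refl with decides n q
  ... | inj₁ d = inj₁ (∧L (thin there id d))
  ... | inj₂ d = inj₂ (thin swap-⊆ id (∧L (thin (λ { (here p) → there (there (here p)) ; (there (here p)) → there (here p) }) id d)))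
  decides {ψ ∷ Φ} m q | inj₂ m' with ∈-map⁻ (neg ψ ∧'_) m'
  decides m (here refl) | inj₂ _ | B , n , refl =
    inj₂ (thin swap-⊆ id (∧L (⇒L (hyp (there (here refl)) (here refl)) ⊥L)))
  decides m (there q) | inj₂ _ | B , n , refl with decides n q
  ... | inj₁ d = inj₁ (∧L (thin there id d))
  ... | inj₂ d = inj₂ (thin swap-⊆ id (∧L (thin (λ { (here p) → there (there (here p)) ; (there (here p)) → there (here p) }) id d)))

-- Closure of a formula

-- fl (□[ α ] φ) contains what has to be decided at a world for the truth lemma, which is less than the
-- Fischer–Ladner closure; flp α φ is the contribution of α.
mutual
  fl : Fm → List Fm
  fl φ = φ ∷ parts φ

  parts : Fm → List Fm
  parts ⊥' = []
  parts (var _) = []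
  parts (φ ∧' ψ) = fl φ ++ fl ψ
  parts (φ ∨' ψ) = fl φ ++ fl ψ
  parts (φ ⇒' ψ) = fl φ ++ fl ψ
  parts (□[ α ] φ) = flp α φ ++ fl φ

  flp : Pg → Fm → List Fm
  flp (atom _) φ = []
  flp (α ⨟ β) φ = (□[ β ] φ) ∷ flp α (□[ β ] φ) ++ flp β φ
  flp (α ∪' β) φ = flp α φ ++ flp β φ
  flp (ψ ¿) φ = fl ψ
  flp (α ⋆) φ = (□[ α ⋆ ] φ) ∷ flp α (□[ α ⋆ ] φ)

-- Canonical model and truth lemma

module Canonical (em : ExcludedMiddle 0ℓ) (x : Label) (Φ : List Fm) where
  open Entailment em x

  World : Set
  World = Σ[ A ∈ Fm ] A ∈ descriptions Φ × ¬ ([ A ] ⊢ [])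

  infix 2 _⊩_
  _⊩_ : World → Fm → Set
  s ⊩ φ = [ proj₁ s ] ⊢ [ φ ]

  -- The relation holds when `s` is consistent with the diamond formula saying that some `a`-step
  -- leads to the description `t`.
  canonical : Model
  canonical = record
    { S = World
    ; V = λ p s → s ⊩ var p
    ; R = λ a s t → ¬ (s ⊩ □[ atom a ] neg (proj₁ t))
    }

  Sat : Fm → World → Set
  Sat = ⟦_⟧F canonical

  Reach : Pg → World → World → Set
  Reach = ⟦_⟧P canonical

  decide : ∀ {φ} (s : World) → φ ∈ Φ → (s ⊩ φ) ⊎ (φ ∷ proj₁ s ∷ [] ⊢ [])
  decide (_ , m , _) = decides m

  refute : ∀ {A φ ψ} → φ ∷ A ∷ [] ⊢ [] → φ ∷ A ∷ [] ⊢ [ ψ ]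
  refute = thin id (λ ())

  from-worlds : ∀ {F} → (∀ s → s ⊩ F) → [] ⊢ [ F ]
  from-worlds h = exhaustive Φ λ {A} m → one m
    where
    one : ∀ {A} → A ∈ descriptions Φ → [ A ] ⊢ [ _ ]
    one {A} m with em {[ A ] ⊢ []}
    ... | yes d = thin id (λ ()) d
    ... | no n = h (A , m , n)

  mutual
    -- Truth lemma. Implications and tests use the opposite direction, so both directions and the
    -- two box lemmas are proved together by recursion on formulas and programs.
    sat⇒⊩ : ∀ φ → fl φ ⊆ Φ → ∀ s → Sat φ s → s ⊩ φ
    sat⇒⊩ (var p) σ s v = v
    sat⇒⊩ (φ ∧' ψ) σ s (u , v) = ∧R (sat⇒⊩ φ (σ ∘ there ∘ ∈-++⁺ˡ) s u) (sat⇒⊩ ψ (σ ∘ there ∘ ∈-++⁺ʳ (fl φ)) s v)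
    sat⇒⊩ (φ ∨' ψ) σ s (inj₁ u) = ∨R (thin id (λ { (here p) → here p }) (sat⇒⊩ φ (σ ∘ there ∘ ∈-++⁺ˡ) s u))
    sat⇒⊩ (φ ∨' ψ) σ s (inj₂ v) = ∨R (thin id there (sat⇒⊩ ψ (σ ∘ there ∘ ∈-++⁺ʳ (fl φ)) s v))
    sat⇒⊩ (φ ⇒' ψ) σ s f with decide s (σ (there (here refl)))
    ... | inj₁ d = ⇒R (thin there id (sat⇒⊩ ψ (σ ∘ there ∘ ∈-++⁺ʳ (fl φ)) s (f (⊩⇒sat φ (σ ∘ there ∘ ∈-++⁺ˡ) s d))))
    ... | inj₂ d = ⇒R (refute d)
    sat⇒⊩ (□[ α ] φ) σ s f = box-intro α φ (σ ∘ there ∘ ∈-++⁺ˡ) φ s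
      λ t r → sat⇒⊩ φ (σ ∘ there ∘ ∈-++⁺ʳ (flp α φ)) t (f t r)

    ⊩⇒sat : ∀ φ → fl φ ⊆ Φ → ∀ s → s ⊩ φ → Sat φ s
    ⊩⇒sat ⊥' σ (A , m , con) d = con (⊢-cut ⊥' d ⊥L)
    ⊩⇒sat (var p) σ s d = d
    ⊩⇒sat (φ ∧' ψ) σ s d =
      ⊩⇒sat φ (σ ∘ there ∘ ∈-++⁺ˡ) s (chain d (∧L (hyp (here refl) (here refl)))) ,
      ⊩⇒sat ψ (σ ∘ there ∘ ∈-++⁺ʳ (fl φ)) s (chain d (∧L (hyp (there (here refl)) (here refl))))
    ⊩⇒sat (φ ∨' ψ) σ s d with decide s (σ (there (here refl)))
    ... | inj₁ e = inj₁ (⊩⇒sat φ (σ ∘ there ∘ ∈-++⁺ˡ) s e)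
    ... | inj₂ e = inj₂ (⊩⇒sat ψ (σ ∘ there ∘ ∈-++⁺ʳ (fl φ)) s
            (⊢-cut (φ ∨' ψ) (thin id (λ { (here p) → here p }) d) (∨L (refute e) (hyp (here refl) (here refl)))))
    ⊩⇒sat (φ ⇒' ψ) σ s d u = ⊩⇒sat ψ (σ ∘ there ∘ ∈-++⁺ʳ (fl φ)) s
      (⊢-cut (φ ⇒' ψ) (thin id (λ { (here p) → here p }) d)
        (⇒L (thin id (λ { (here p) → here p }) (sat⇒⊩ φ (σ ∘ there ∘ ∈-++⁺ˡ) s u)) (hyp (here refl) (here refl))))
    ⊩⇒sat (□[ α ] φ) σ s d t r = ⊩⇒sat φ (σ ∘ there ∘ ∈-++⁺ʳ (flp α φ)) t
      (box-elim α φ (σ ∘ there ∘ ∈-++⁺ˡ) (σ (there (∈-++⁺ʳ (flp α φ) (here refl)))) s t d r)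

    -- The formula handed on at each intermediate world must be decided there, which is why the
    -- closure contains `[β]φ` for compositions and `[α⋆]φ` for stars.
    box-elim : ∀ α φ → flp α φ ⊆ Φ → φ ∈ Φ → ∀ s t → s ⊩ □[ α ] φ → Reach α s t → t ⊩ φ
    box-elim (atom a) φ σ m s t d r with decide t m
    ... | inj₁ e = e
    ... | inj₂ e = ⊥-elim (r (box-mono a [ φ ] (⇒R (thin swap-⊆ (λ ()) e)) λ { (here refl) → d }))
    box-elim (α ⨟ β) φ σ m s t d (u , r , r') =
      box-elim β φ (σ ∘ there ∘ ∈-++⁺ʳ (flp α (□[ β ] φ))) m u t
        (box-elim α (□[ β ] φ) (σ ∘ there ∘ ∈-++⁺ˡ) (σ (here refl)) s u
          (chain d (derive em (seqL x α β φ [] _) (hyp (here refl) (here refl) ∷ []))) r) r'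
    box-elim (α ∪' β) φ σ m s t d (inj₁ r) = box-elim α φ (σ ∘ ∈-++⁺ˡ) m s t
      (chain d (derive em (unionL x α β φ [] _) (hyp {Γ = _ ∷ (□[ β ] φ) ∷ []} (here refl) (here refl) ∷ []))) r
    box-elim (α ∪' β) φ σ m s t d (inj₂ r) = box-elim β φ (σ ∘ ∈-++⁺ʳ (flp α φ)) m s t
      (chain d (derive em (unionL x α β φ [] _) (hyp {Γ = (□[ α ] φ) ∷ _ ∷ []} (there (here refl)) (here refl) ∷ []))) r
    box-elim (ψ ¿) φ σ m s .s d (refl , u) =
      ⊢-cut (□[ ψ ¿ ] φ) (thin id (λ { (here p) → here p }) d)
        (derive em (testL x ψ φ [ x ∶ proj₁ s ] _)
          (thin {Δ = [ ψ ]} {Δ' = ψ ∷ φ ∷ []} id (λ { (here p) → here p }) (sat⇒⊩ ψ σ s u) ∷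
           hyp {Γ = φ ∷ proj₁ s ∷ []} (here refl) (here refl) ∷ []))
    box-elim (α ⋆) φ σ m s t d r = along s d r
      where
      unfold : ∀ {Δ} → φ ∷ (□[ α ] □[ α ⋆ ] φ) ∷ [] ⊢ Δ → [ □[ α ⋆ ] φ ] ⊢ Δ
      unfold e = derive em (starL x α φ [] _) (e ∷ [])
      along : ∀ s → s ⊩ □[ α ⋆ ] φ → Star (Reach α) s t → t ⊩ φ
      along s d ε = chain d (unfold (hyp (here refl) (here refl)))
      along s d (_◅_ {j = u} r rs) = along u
        (box-elim α (□[ α ⋆ ] φ) (σ ∘ there) (σ (here refl)) s u
          (chain d (unfold (hyp (there (here refl)) (here refl)))) r) rs

    -- `F` is kept apart from `φ`: `flp α φ` covers the tests inside `α`, while for a star `F`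
    -- becomes an invariant that need not belong to `Φ`.
    box-intro : ∀ α φ → flp α φ ⊆ Φ → ∀ F s → (∀ t → Reach α s t → t ⊩ F) → s ⊩ □[ α ] F
    -- `excluded` holds the negated descriptions whose box `s` entails. Every description is
    -- inconsistent, contradicted by `excluded`, or an actual successor, so `excluded` entails `F`.
    box-intro (atom a) φ σ F s h = box-mono a excluded (exhaustive Φ one) (λ m → chosen m)
      where
      Excluded : Fm → Set
      Excluded G = s ⊩ □[ atom a ] G
      excluded = filter (λ G → em {Excluded G}) (map neg (descriptions Φ))
      chosen : ∀ {G} → G ∈ excluded → s ⊩ □[ atom a ] G
      chosen m = proj₂ (∈-filter⁻ (λ G → em {Excluded G}) {xs = map neg (descriptions Φ)} m)
      one : ∀ {B} → B ∈ descriptions Φ → B ∷ excluded ⊢ [ F ]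
      one {B} m with em {[ B ] ⊢ []}
      ... | yes d = thin (λ { (here p) → here p }) (λ ()) d
      ... | no con with em {Excluded (neg B)}
      ... | yes e = ⊢-cut (neg B) (hyp (there (∈-filter⁺ (λ G → em {Excluded G}) (∈-map⁺ neg m) e)) (here refl))
                      (⇒L (hyp (here refl) (here refl)) ⊥L)
      ... | no ¬e = thin (λ { (here p) → here p }) id (h (B , m , con) ¬e)
    box-intro (α ⨟ β) φ σ F s h = derive em (seqR x α β F _ [])
      (box-intro α (□[ β ] φ) (σ ∘ there ∘ ∈-++⁺ˡ) (□[ β ] F) s (λ u r →
        box-intro β φ (σ ∘ there ∘ ∈-++⁺ʳ (flp α (□[ β ] φ))) F u (λ t r' → h t (u , r , r'))) ∷ [])
    box-intro (α ∪' β) φ σ F s h = derive em (unionR x α β F _ [])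
      (box-intro α φ (σ ∘ ∈-++⁺ˡ) F s (λ t r → h t (inj₁ r)) ∷
       box-intro β φ (σ ∘ ∈-++⁺ʳ (flp α φ)) F s (λ t r → h t (inj₂ r)) ∷ [])
    box-intro (ψ ¿) φ σ F s h = derive em (testR x ψ F [ x ∶ proj₁ s ] []) (body' ∷ [])
      where
      body' : ψ ∷ proj₁ s ∷ [] ⊢ [ F ]
      body' with decide s (σ (here refl))
      ... | inj₁ d = thin there id (h s (refl , ⊩⇒sat ψ σ s d))
      ... | inj₂ d = refute d
    -- The invariant `X` is the disjunction of the worlds reachable from `s`. Each entails `F`, and
    -- by induction on `α` each entails `[α]X`, since one more step stays among them.
    box-intro (α ⋆) φ σ F s h = chain (inX s ε)
      (loop-rule em x F α X
        (disj-elim reached λ m → let (t , r , e) = chosen m in ≡-subst (λ B → [ B ] ⊢ [ F ]) e (h t r))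
        (disj-elim reached λ m → let (t , r , e) = chosen m in ≡-subst (λ B → [ B ] ⊢ [ □[ α ] X ]) e
          (box-intro α (□[ α ⋆ ] φ) (σ ∘ there) X t λ u r' → inX u (r ◅◅ (r' ◅ ε)))))
      where
      Reached : Fm → Set
      Reached B = Σ[ t ∈ World ] Star (Reach α) s t × proj₁ t ≡ B
      reached = filter (λ B → em {Reached B}) (descriptions Φ)
      X = disj reached
      chosen : ∀ {B} → B ∈ reached → Reached B
      chosen m = proj₂ (∈-filter⁻ (λ B → em {Reached B}) {xs = descriptions Φ} m)
      inX : ∀ t → Star (Reach α) s t → t ⊩ X
      inX t r = disj-intro (∈-filter⁺ (λ B → em {Reached B}) (proj₁ (proj₂ t)) (t , r , refl))

theorem3 : ExcludedMiddle 0ℓ → (φ : Fm) → Valid φ →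
    (x : Label) → Derivableω ([] ⇒ [ x ∶ φ ])
theorem3 em φ valid x = from-worlds λ s → sat⇒⊩ φ id s (valid canonical s)
  where open Canonical em x (fl φ)
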